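{- If $P$ is a $d$-dimensional $k\times\cdots\times k$ permutation matrix, or a tuple permutation matrix generated by such a permutation matrix, then $S(P,d)=2^{O(k)}$. Explicitly: for every fixed $d\ge 1$ and every fixed $j\ge 1$ there is a constant $C>0$ such that for every $k\ge 1$ and every $P$ that is a $j$-tuple permutation matrix generated by a $d$-dimensional $k\times\cdots\times k$ permutation matrix (the case $j=1$ being the permutation matrices themselves), $S(P,d)\le 2^{Ck}$.
   Context: A $d$-dimensional $n_1\times\cdots\times n_d$ zero-one matrix is an array $A=(a_{i_1,\ldots,i_d})$, $1\le i_\ell\le n_\ell$, with entries in $\{0,1\}$. A submatrix is obtained by selecting, for each $\ell$, a set of values of the $\ell$-th coordinate (keeping the order). $A$ contains a $d$-dimensional zero-one matrix $B$ if some submatrix of $A$ can be transformed into $B$ by changing any number of ones to zeros; otherwise $A$ avoids $B$. $f(n,B,d)$ denotes the maximum number of ones in a $d$-dimensional $n\times\cdots\times n$ zero-one matrix that avoids $B$, and $$S(P,d)=\limsup_{n\to\infty}\frac{f(n,P,d)}{n^{d-1}}.$$ An $\ell$-cross section is the set of all entries having a fixed value of the $\ell$-th coordinate. A $d$-dimensional $k\times\cdots\times k$ zero-one matrix is a permutation matrix if each of its $\ell$-cross sections contains exactly one nonzero entry, for every $\ell=1,\ldots,d$. $R^{k_1,\ldots,k_d}$ is the $k_1\times\cdots\times k_d$ matrix of all ones, and the Kronecker product $M\otimes N$ is obtained by replacing each $1$-entry of $M$ by a copy of $N$ and each $0$-entry of $M$ by a zero matrix of the same size as $N$. For a permutation matrix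 $P'$, the matrix $P'\otimes R^{k_1,\ldots,k_d}$ is called a $j$-tuple permutation matrix generated by $P'$ if one of $k_1,\ldots,k_d$ equals $j$ and the rest equal $1$; a tuple permutation matrix is a $j$-tuple permutation matrix for some $j\ge 2$. -}

module Defs where

open import Level using (0ℓ)
open import Data.Bool using (Bool; true; false; _∧_)
import Data.Bool.Properties as Bool
open import Data.Fin as Fin using (Fin; zero; suc)
import Data.Fin.Properties as Fin
open import Data.Integer using (+_)
open import Data.List as List using (List; []; _∷_)
open import Data.List.Extrema.Nat using (max; xs≤max; argmax-sel)
import Data.List.Membership.Propositional as List
import Data.List.Membership.Propositional.Properties as List
open import Data.List.Relation.Unary.Any using (here; there)
import Data.List.Relation.Unary.All as ListAll
open import Data.Nat as ℕ using (ℕ; zero; suc; _*_; _^_; _∸_; _≤_)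
import Data.Nat.Properties as ℕ
open import Data.Product using (Σ; ∃; ∃!; ∃₂; _×_; _,_; proj₂)
open import Data.Rational as ℚ using (ℚ)
open import Data.Sum using (inj₁; inj₂)
open import Data.Unit using (⊤; tt)
open import Data.Vec as Vec using (Vec; []; _∷_; lookup; replicate; zipWith; _[_]≔_)
open import Data.Vec.Relation.Binary.Pointwise.Inductive using (Pointwise; []; _∷_)
open import Data.Vec.Relation.Unary.All using (All; []; _∷_)
open import Function using (id)
open import Relation.Binary.Core using (_Preserves_⟶_)
open import Relation.Binary.PropositionalEquality using (_≡_; refl; sym; subst)
open import Relation.Nullary using (¬_; Dec; yes; no; ¬?; _×-dec_; _→-dec_)
import Relation.Nullary.Decidable as Dec
open import Relation.Unary using (Pred; Decidable)

private
  variable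
    A : Set
    d n : ℕ

Matrix : Vec ℕ d → Set
Matrix []       = Bool
Matrix (n ∷ ns) = Vec (Matrix ns) n

Index : Vec ℕ d → Set
Index ns = All Fin ns

infixl 9 _!_
_!_ : {ns : Vec ℕ d} → Matrix ns → Index ns → Bool
M ! []       = M
M ! (i ∷ is) = lookup M i ! is

coordinate : {ns : Vec ℕ d} (ℓ : Fin d) → Index ns → Fin (lookup ns ℓ)
coordinate zero    (i ∷ _)  = i
coordinate (suc ℓ) (_ ∷ is) = coordinate ℓ is

ones : (ns : Vec ℕ d) → Matrix ns → ℕ
ones []       true  = 1
ones []       false = 0
ones (n ∷ ns) M     = Vec.sum (Vec.map (ones ns) M)

cube : (d n : ℕ) → Vec ℕ d
cube d n = replicate d n

-- For each axis, m values out of the n possible values of that coordinate.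
Selection : Vec ℕ d → Vec ℕ d → Set
Selection = Pointwise (λ m n → Vec (Fin n) m)

-- Strictly increasing lists of coordinate values stand for sets of values.
Increasing : {ms ns : Vec ℕ d} → Selection ms ns → Set
Increasing []      = ⊤
Increasing (v ∷ σ) = (lookup v Preserves Fin._<_ ⟶ Fin._<_) × Increasing σ

submatrix : {ms ns : Vec ℕ d} → Selection ms ns → Matrix ns → Matrix ms
submatrix []      M = M
submatrix (v ∷ σ) M = Vec.map (λ i → submatrix σ (lookup M i)) v

-- B arises from M by changing some ones to zeros.
infix 4 _≼_
_≼_ : {ns : Vec ℕ d} → Matrix ns → Matrix ns → Set
_≼_ {ns = ns} B M = (i : Index ns) → B ! i ≡ true → M ! i ≡ true

Contains : {ms ns : Vec ℕ d} → Matrix ns → Matrix ms → Set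
Contains {ms = ms} {ns = ns} M B =
  Σ (Selection ms ns) λ σ → Increasing σ × _≼_ {ns = ms} B (submatrix σ M)

Avoids : {ms ns : Vec ℕ d} → Matrix ns → Matrix ms → Set
Avoids {ms = ms} {ns = ns} M B = ¬ Contains {ms = ms} {ns = ns} M B

Searchable : Set → Set₁
Searchable X = {P : Pred X 0ℓ} → Decidable P → Dec (∃ P)

search-Vec : Searchable A → ∀ m → Searchable (Vec A m)
search-Vec s zero    P? = Dec.map′ ([] ,_) (λ { ([] , p) → p }) (P? [])
search-Vec s (suc m) P? =
  Dec.map′ (λ (x , xs , p) → x ∷ xs , p) (λ { (x ∷ xs , p) → x , xs , p })
    (s λ x → search-Vec s m λ xs → P? (x ∷ xs))

search-Selection : (ms ns : Vec ℕ d) → Searchable (Selection ms ns)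
search-Selection []       []       P? = Dec.map′ ([] ,_) (λ { ([] , p) → p }) (P? [])
search-Selection (m ∷ ms) (n ∷ ns) P? =
  Dec.map′ (λ (v , σ , p) → v ∷ σ , p) (λ { (v ∷ σ , p) → v , σ , p })
    (search-Vec Fin.any? m λ v → search-Selection ms ns λ σ → P? (v ∷ σ))

increasing? : {ms ns : Vec ℕ d} → Decidable (Increasing {ms = ms} {ns = ns})
increasing? []      = yes tt
increasing? (v ∷ σ) =
  Dec.map′ (λ h {i} {i′} → h i i′) (λ h i i′ → h {i} {i′})
    (Fin.all? λ i → Fin.all? λ i′ → (i Fin.<? i′) →-dec (lookup v i Fin.<? lookup v i′))
  ×-dec increasing? σ

all-Index? : (ns : Vec ℕ d) {P : Pred (Index ns) 0ℓ} → Decidable P → Dec (∀ i → P i)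
all-Index? []       P? = Dec.map′ (λ { p [] → p }) (λ p → p []) (P? [])
all-Index? (n ∷ ns) P? =
  Dec.map′ (λ { p (i ∷ is) → p i is }) (λ p i is → p (i ∷ is))
    (Fin.all? λ i → all-Index? ns λ is → P? (i ∷ is))

≼-dec : (ns : Vec ℕ d) (B M : Matrix ns) → Dec (_≼_ {ns = ns} B M)
≼-dec ns B M =
  all-Index? ns λ i → ((B ! i) Bool.≟ true) →-dec ((M ! i) Bool.≟ true)

avoids? : (ms ns : Vec ℕ d) (B : Matrix ms) →
          Decidable (λ M → Avoids {ms = ms} {ns = ns} M B)
avoids? ms ns B M = ¬?
  (search-Selection ms ns λ σ → increasing? σ ×-dec ≼-dec ms B (submatrix σ M))

allVecs : List A → ∀ n → List (Vec A n)
allVecs xs zero    = [] ∷ []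
allVecs xs (suc n) = List.cartesianProductWith _∷_ xs (allVecs xs n)

allMatrices : (ns : Vec ℕ d) → List (Matrix ns)
allMatrices []       = false ∷ true ∷ []
allMatrices (n ∷ ns) = allVecs (allMatrices ns) n

-- The value is 0 if no matrix avoids B; this never happens when B has a one.
f : {ps : Vec ℕ d} (n : ℕ) → Matrix ps → ℕ
f {d = d} {ps = ps} n B = max 0
  (List.map (ones (cube d n))
    (List.filter (avoids? ps (cube d n) B) (allMatrices (cube d n))))

∈-allVecs : {xs : List A} → (∀ x → x List.∈ xs) → (v : Vec A n) → v List.∈ allVecs xs n
∈-allVecs h []      = here refl
∈-allVecs h (x ∷ v) = List.∈-cartesianProductWith⁺ _∷_ (h x) (∈-allVecs h v)

∈-allMatrices : (ns : Vec ℕ d) (M : Matrix ns) → M List.∈ allMatrices ns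
∈-allMatrices []       false = here refl
∈-allMatrices []       true  = there (here refl)
∈-allMatrices (n ∷ ns) M     = ∈-allVecs (∈-allMatrices ns) M

module _ {ps : Vec ℕ d} (n : ℕ) (B : Matrix ps) where

  private
    □ : Vec ℕ d
    □ = cube d n

  f-upper : (M : Matrix □) → Avoids {ms = ps} {ns = □} M B → ones □ M ≤ f {ps = ps} n B
  f-upper M av = ListAll.lookup (xs≤max 0 _)
    (List.∈-map⁺ (ones □) (List.∈-filter⁺ (avoids? ps □ B) (∈-allMatrices □ M) av))

  f-attained : (M : Matrix □) → Avoids {ms = ps} {ns = □} M B →
               ∃ λ (N : Matrix □) →
                 Avoids {ms = ps} {ns = □} N B × ones □ N ≡ f {ps = ps} n B
  f-attained M av
    with argmax-sel id 0 (List.map (ones □) (List.filter (avoids? ps □ B) (allMatrices □)))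
  ... | inj₁ f≡0 = M , av , ℕ.≤-antisym (f-upper M av)
                              (subst (_≤ ones □ M) (sym f≡0) ℕ.z≤n)
  ... | inj₂ f∈ with List.∈-map⁻ (ones □) f∈
  ...   | N , N∈ , f≡ =
          N , proj₂ (List.∈-filter⁻ (avoids? ps □ B) {xs = allMatrices □} N∈) , sym f≡

-- The limit superior of a rational sequence is in general an irrational or
-- infinite quantity x; it is represented by its upper cut { q ∈ ℚ ∣ x < q }.
UpperReal : Set₁
UpperReal = Pred ℚ 0ℓ

-- limsup a < q iff some r < q is an upper bound for a tail of a.
limsup : (ℕ → ℚ) → UpperReal
limsup a q = ∃₂ λ (r : ℚ) (N : ℕ) → r ℚ.< q × (∀ n → N ≤ n → a n ℚ.≤ r)

infix 4 _≤ᵁ_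
_≤ᵁ_ : UpperReal → ℚ → Set
x ≤ᵁ r = ∀ q → r ℚ.< q → x q

-- The sequence is indexed from side length 1 to avoid division by zero; the
-- exponent is d - 1 only for d ≥ 1.
S : {ps : Vec ℕ d} → Matrix ps → UpperReal
S {d = d} {ps = ps} P = limsup λ n →
  ℚ._/_ (+ f {ps = ps} (suc n) P) (suc n ^ (d ∸ 1)) {{ℕ.m^n≢0 (suc n) (d ∸ 1)}}

IsPermutation : (d k : ℕ) → Matrix (cube d k) → Set
IsPermutation d k P =
  (ℓ : Fin d) (c : Fin (lookup (cube d k) ℓ)) →
  ∃! _≡_ λ (i : Index (cube d k)) → coordinate ℓ i ≡ c × P ! i ≡ true

infixr 7 _⊗_
_⊗_ : {ms ns : Vec ℕ d} → Matrix ms → Matrix ns → Matrix (zipWith _*_ ms ns)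
_⊗_ {ms = []}     {ns = []}     M N = M ∧ N
_⊗_ {ms = m ∷ ms} {ns = n ∷ ns} M N =
  Vec.concat (Vec.map (λ M′ → Vec.map (λ N′ → _⊗_ {ms = ms} {ns = ns} M′ N′) N) M)

R : (ks : Vec ℕ d) → Matrix ks
R []       = true
R (k ∷ ks) = replicate k (R ks)

-- For j = 1 the second factor is a single 1-entry: these are the permutation
-- matrices themselves, with shape entries written k * 1.
data IsTuplePermutation (d k j : ℕ) : {ps : Vec ℕ d} → Matrix ps → Set where
  generated : (P′ : Matrix (cube d k)) → IsPermutation d k P′ → (ℓ : Fin d) →
              IsTuplePermutation d k j
                (_⊗_ {ms = cube d k} {ns = replicate d 1 [ ℓ ]≔ j} P′ (R (replicate d 1 [ ℓ ]≔ j)))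

{-# OPTIONS --safe #-}
module Submission where

-- The argument is Fox's interval-minor proof of the exponential Stanley–Wilf
-- bound, run on segments instead of single ones. Fix the axis ℓ along which the
-- pattern is j-fold, and call an interval of a line parallel to ℓ good if it
-- contains j ones. Up to a factor j, the ones on a line are counted by the maximum
-- number ν of disjoint good intervals, and it suffices to find a k × ⋯ × k grid
-- all of whose cells contain a good interval: such a grid yields every tuple
-- permutation pattern.
--
-- Without such a grid, the sum of ν over all lines is bounded by contracting
-- blocks of t = 4^k consecutive coordinates. If few lines of a block have good
-- intervals in a stretch, contraction loses only a small factor there. The
-- remaining stretches have good intervals on at least 2^(k-1) lines of a block of
-- t lines; halving the block repeatedly, as Fox does, splits off the k cells of
-- the grid in that direction, so these stretches are bounded by the same problem
-- in one dimension less. Contracting also along ℓ loses intervals inside one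
-- block of length t; the blocks with such intervals are the ones of a
-- (D+1)-dimensional matrix, bounded by the plain (j = 1) version.

open import Defs
open import Data.Bool using (Bool; true; false; T; if_then_else_; _∧_; _∨_)
open import Data.Bool.Properties using (T-∧; T-∨; T-≡; ∧-identityʳ)
open import Data.Empty using (⊥-elim)
open import Data.Fin as Fin using (Fin; zero; suc; toℕ; fromℕ<; quotient; remainder)
import Data.Fin.Properties as Fin
open import Data.Fin.Properties using (toℕ<n; toℕ-fromℕ<; fromℕ<-toℕ)
import Data.List.Extrema.Nat as List
import Data.List.Relation.Unary.All as ListAll
import Data.List.Relation.Unary.All.Properties as ListAll
open import Data.Nat as ℕ using (ℕ; zero; suc; _+_; _*_; _^_; _∸_; _≤_; _<_; _≤ᵇ_; _<ᵇ_; z≤n; s≤s; s≤s⁻¹; NonZero)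
open import Data.Nat.DivMod hiding (_/_)
open import Data.Nat.Divisibility using (divides-refl)
open import Data.Nat.Properties
open import Data.Nat.Solver using (module +-*-Solver)
open import Data.Product using (∃; _×_; _,_; proj₁; proj₂)
import Data.Rational as ℚ
import Data.Rational.Properties as ℚ
open import Data.Rational.Unnormalised as ℚᵘ using (mkℚᵘ)
import Data.Rational.Unnormalised.Properties as ℚᵘ
open import Data.Sum using (_⊎_; inj₁; inj₂)
open import Data.Unit using (⊤; tt)
open import Data.Vec as Vec using (Vec; []; _∷_; insertAt; removeAt; updateAt; replicate; lookup; tabulate; zipWith; _[_]≔_)
open import Data.Vec.Properties using (insertAt-lookup; insertAt-punchIn; lookup-concat; lookup-map; lookup∘tabulate; lookup∘update; lookup∘update′; lookup-replicate)
open import Data.Vec.Relation.Binary.Pointwise.Inductive as Pointwise using (Pointwise; []; _∷_)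
open import Data.Vec.Relation.Unary.All using ([]; _∷_)
open import Function using (_∘_; Equivalence)
open import Relation.Binary.Definitions using (tri<; tri≈; tri>)
open import Relation.Binary.PropositionalEquality
open import Relation.Nullary using (¬_; yes; no)
open import Algebra.Properties.CommutativeSemigroup +-commutativeSemigroup using (interchange)

-- Sums over ranges and boxes

∑< : ℕ → (ℕ → ℕ) → ℕ
∑< zero    f = 0
∑< (suc n) f = ∑< n f + f n

∑<-mono-< : ∀ n {f g : ℕ → ℕ} → (∀ i → i < n → f i ≤ g i) → ∑< n f ≤ ∑< n g
∑<-mono-< zero    h = z≤n
∑<-mono-< (suc n) h = +-mono-≤ (∑<-mono-< n (λ i i<n → h i (m<n⇒m<1+n i<n))) (h n ≤-refl)

∑<-mono : ∀ n {f g : ℕ → ℕ} → (∀ i → f i ≤ g i) → ∑< n f ≤ ∑< n g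
∑<-mono n h = ∑<-mono-< n (λ i _ → h i)

∑<-cong : ∀ n {f g : ℕ → ℕ} → (∀ i → f i ≡ g i) → ∑< n f ≡ ∑< n g
∑<-cong zero    h = refl
∑<-cong (suc n) h = cong₂ _+_ (∑<-cong n h) (h n)

∑<-+ : ∀ n (f g : ℕ → ℕ) → ∑< n (λ i → f i + g i) ≡ ∑< n f + ∑< n g
∑<-+ zero    f g = refl
∑<-+ (suc n) f g = trans (cong (_+ (f n + g n)) (∑<-+ n f g)) (interchange (∑< n f) (∑< n g) (f n) (g n))

∑<-*ʳ : ∀ n (f : ℕ → ℕ) c → ∑< n (λ i → f i * c) ≡ ∑< n f * c
∑<-*ʳ zero    f c = refl
∑<-*ʳ (suc n) f c = trans (cong (_+ f n * c) (∑<-*ʳ n f c)) (sym (*-distribʳ-+ c (∑< n f) (f n)))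

∑<-*ˡ : ∀ n c (f : ℕ → ℕ) → ∑< n (λ i → c * f i) ≡ c * ∑< n f
∑<-*ˡ zero    c f = sym (*-zeroʳ c)
∑<-*ˡ (suc n) c f = trans (cong (_+ c * f n) (∑<-*ˡ n c f)) (sym (*-distribˡ-+ c (∑< n f) (f n)))

∑<-const : ∀ n c → ∑< n (λ _ → c) ≡ n * c
∑<-const zero    c = refl
∑<-const (suc n) c = trans (+-comm _ c) (cong (c +_) (∑<-const n c))

∑<-split : ∀ m n (f : ℕ → ℕ) → ∑< (m + n) f ≡ ∑< m f + ∑< n (λ i → f (m + i))
∑<-split m zero    f = trans (cong (λ z → ∑< z f) (+-identityʳ m)) (sym (+-identityʳ _))
∑<-split m (suc n) f rewrite +-suc m n =
  trans (cong (_+ f (m + n)) (∑<-split m n f)) (+-assoc (∑< m f) _ _)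

∑<-blocks : ∀ N t (f : ℕ → ℕ) → ∑< (N * t) f ≡ ∑< N (λ c → ∑< t (λ u → f (c * t + u)))
∑<-blocks zero    t f = refl
∑<-blocks (suc N) t f rewrite +-comm t (N * t) =
  trans (∑<-split (N * t) t f) (cong (_+ ∑< t (λ u → f (N * t + u))) (∑<-blocks N t f))

∑<-monoˡ : ∀ {m n} (f : ℕ → ℕ) → m ≤ n → ∑< m f ≤ ∑< n f
∑<-monoˡ {m} {n} f m≤n = subst (λ z → ∑< m f ≤ ∑< z f) (m+[n∸m]≡n m≤n)
  (≤-trans (m≤m+n _ _) (≤-reflexive (sym (∑<-split m (n ∸ m) f))))

∑<-≥1 : ∀ {i n} (f : ℕ → ℕ) → i < n → f i ≤ ∑< n f
∑<-≥1 {i} f i<n = ≤-trans (m≤n+m (f i) (∑< i f)) (∑<-monoˡ f i<n)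

∑□ : ∀ {D} → Vec ℕ D → (Vec ℕ D → ℕ) → ℕ
∑□ []       g = g []
∑□ (N ∷ Ns) g = ∑< N (λ c → ∑□ Ns (λ x → g (c ∷ x)))

∑□-mono : ∀ {D} (Ns : Vec ℕ D) {f g : Vec ℕ D → ℕ} → (∀ x → f x ≤ g x) → ∑□ Ns f ≤ ∑□ Ns g
∑□-mono []       h = h []
∑□-mono (N ∷ Ns) h = ∑<-mono N (λ c → ∑□-mono Ns (λ x → h (c ∷ x)))

∑□-+ : ∀ {D} (Ns : Vec ℕ D) (f g : Vec ℕ D → ℕ) → ∑□ Ns (λ x → f x + g x) ≡ ∑□ Ns f + ∑□ Ns g
∑□-+ []       f g = refl
∑□-+ (N ∷ Ns) f g = trans (∑<-cong N (λ c → ∑□-+ Ns _ _)) (∑<-+ N _ _)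

∑□-*ˡ : ∀ {D} (Ns : Vec ℕ D) c (f : Vec ℕ D → ℕ) → ∑□ Ns (λ x → c * f x) ≡ c * ∑□ Ns f
∑□-*ˡ []       c f = refl
∑□-*ˡ (N ∷ Ns) c f = trans (∑<-cong N (λ _ → ∑□-*ˡ Ns c _)) (∑<-*ˡ N c _)

∑□-zero : ∀ {D} (Ns : Vec ℕ D) → ∑□ Ns (λ _ → 0) ≡ 0
∑□-zero []       = refl
∑□-zero (N ∷ Ns) = trans (∑<-cong N (λ _ → ∑□-zero Ns)) (trans (∑<-const N 0) (*-zeroʳ N))

∑□-monoˡ : ∀ {D} {Ns Ns′ : Vec ℕ D} (f : Vec ℕ D → ℕ) → Pointwise _≤_ Ns Ns′ → ∑□ Ns f ≤ ∑□ Ns′ f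
∑□-monoˡ f []                   = ≤-refl
∑□-monoˡ {Ns = N ∷ _} f (N≤ ∷ h) =
  ≤-trans (∑<-mono N (λ c → ∑□-monoˡ (λ x → f (c ∷ x)) h)) (∑<-monoˡ _ N≤)

∑<-∑□-swap : ∀ {D} n (Ns : Vec ℕ D) (f : ℕ → Vec ℕ D → ℕ) →
             ∑< n (λ i → ∑□ Ns (f i)) ≡ ∑□ Ns (λ x → ∑< n (λ i → f i x))
∑<-∑□-swap zero    Ns f = sym (∑□-zero Ns)
∑<-∑□-swap (suc n) Ns f = trans (cong (_+ ∑□ Ns (f n)) (∑<-∑□-swap n Ns f)) (sym (∑□-+ Ns _ _))

∑<-swap : ∀ m n (f : ℕ → ℕ → ℕ) → ∑< m (λ i → ∑< n (f i)) ≡ ∑< n (λ j → ∑< m (λ i → f i j))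
∑<-swap m n f = ∑<-∑□-swap m (n ∷ []) (λ { i (j ∷ []) → f i j })

∑□-insertAt : ∀ {D} (Ns : Vec ℕ D) m N (g : Vec ℕ (suc D) → ℕ) →
              ∑□ (insertAt Ns m N) g ≡ ∑< N (λ c → ∑□ Ns (λ x → g (insertAt x m c)))
∑□-insertAt Ns        zero    N g = refl
∑□-insertAt (N′ ∷ Ns) (suc m) N g =
  trans (∑<-cong N′ (λ c → ∑□-insertAt Ns m N _)) (∑<-swap N′ N _)

⟦_⟧ : Bool → ℕ
⟦ true  ⟧ = 1
⟦ false ⟧ = 0

⟦⟧≤1 : ∀ b → ⟦ b ⟧ ≤ 1
⟦⟧≤1 true  = ≤-refl
⟦⟧≤1 false = z≤n

⟦⟧-T : ∀ {b} → T b → ⟦ b ⟧ ≡ 1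
⟦⟧-T {true} _ = refl

⟦⟧-mono : ∀ {a b} → (T a → T b) → ⟦ a ⟧ ≤ ⟦ b ⟧
⟦⟧-mono {false}         h = z≤n
⟦⟧-mono {true}  {true}  h = ≤-refl
⟦⟧-mono {true}  {false} h = ⊥-elim (h tt)

count : ℕ → (ℕ → Bool) → ℕ
count n p = ∑< n (λ i → ⟦ p i ⟧)

count-∃ : ∀ n (p : ℕ → Bool) → 1 ≤ count n p → ∃ λ i → i < n × T (p i)
count-∃ (suc n) p h with p n in eq
... | true  = n , ≤-refl , subst T (sym eq) tt
... | false with count-∃ n p (subst (1 ≤_) (+-identityʳ _) h)
...   | i , i<n , pi = i , m<n⇒m<1+n i<n , pi

∃-count : ∀ {n i} (p : ℕ → Bool) → i < n → T (p i) → 1 ≤ count n p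
∃-count p i<n pi = subst (_≤ _) (⟦⟧-T pi) (∑<-≥1 (λ i → ⟦ p i ⟧) i<n)

atLeast : ℕ → ℕ → (ℕ → Bool) → Bool
atLeast s n p = s ≤ᵇ count n p

atLeast-map : ∀ {s n} {p q : ℕ → Bool} → (∀ i → T (p i) → T (q i)) →
              T (atLeast s n p) → T (atLeast s n q)
atLeast-map {s} {n} h l = ≤⇒≤ᵇ (≤-trans (≤ᵇ⇒≤ s _ l) (∑<-mono n (λ i → ⟦⟧-mono (h i))))

-- Greedy packing of intervals

Intervals : Set
Intervals = ℕ → ℕ → Bool

Monotone : Intervals → Set
Monotone E = ∀ {a a′ b b′} → a′ ≤ a → b ≤ b′ → T (E a b) → T (E a′ b′)

greedy : Intervals → ℕ → ℕ × ℕ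
greedy E zero    = 0 , 0
greedy E (suc n) =
  if E (proj₁ (greedy E n)) (suc n)
  then (suc n , suc (proj₂ (greedy E n)))
  else greedy E n

-- For monotone E, ν E n is the maximum number of disjoint intervals [a, b) ⊆ [0, n)
-- with E a b; ν-grows and ν-least characterise it.
cut ν : Intervals → ℕ → ℕ
cut E n = proj₁ (greedy E n)
ν   E n = proj₂ (greedy E n)

data Step (E : Intervals) (n : ℕ) : Set where
  fire : T (E (cut E n) (suc n)) → cut E (suc n) ≡ suc n → ν E (suc n) ≡ suc (ν E n) → Step E n
  skip : ¬ T (E (cut E n) (suc n)) → cut E (suc n) ≡ cut E n → ν E (suc n) ≡ ν E n → Step E n

step : ∀ E n → Step E n
step E n with E (cut E n) (suc n) in eq
... | true  = fire (subst T (sym eq) tt)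
                   (cong (λ b → proj₁ (if b then (suc n , suc (ν E n)) else greedy E n)) eq)
                   (cong (λ b → proj₂ (if b then (suc n , suc (ν E n)) else greedy E n)) eq)
... | false = skip (subst T eq)
                   (cong (λ b → proj₁ (if b then (suc n , suc (ν E n)) else greedy E n)) eq)
                   (cong (λ b → proj₂ (if b then (suc n , suc (ν E n)) else greedy E n)) eq)

ascending⇒mono : (φ : ℕ → ℕ) → (∀ n → φ n ≤ φ (suc n)) → ∀ {m n} → m ≤ n → φ m ≤ φ n
ascending⇒mono φ h {n = zero}  z≤n = ≤-refl
ascending⇒mono φ h {n = suc n} m≤  with m≤n⇒m<n∨m≡n m≤
... | inj₁ (s≤s m≤n) = ≤-trans (ascending⇒mono φ h m≤n) (h n)
... | inj₂ refl      = ≤-refl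

cut≤ : ∀ E n → cut E n ≤ n
cut≤ E zero    = z≤n
cut≤ E (suc n) with step E n
... | fire _ eq _ = ≤-reflexive eq
... | skip _ eq _ = subst (_≤ suc n) (sym eq) (m≤n⇒m≤1+n (cut≤ E n))

ν-ascending : ∀ E n → ν E n ≤ ν E (suc n)
ν-ascending E n with step E n
... | fire _ _ eq = subst (ν E n ≤_) (sym eq) (n≤1+n _)
... | skip _ _ eq = ≤-reflexive (sym eq)

ν-monoʳ : ∀ E {m n} → m ≤ n → ν E m ≤ ν E n
ν-monoʳ E = ascending⇒mono (ν E) (ν-ascending E)

cut-or-false : ∀ E n → cut E n ≡ n ⊎ ¬ T (E (cut E n) n)
cut-or-false E zero = inj₁ refl
cut-or-false E (suc n) with step E n
... | fire _ eq _ = inj₁ eq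
... | skip ¬e eq _ rewrite eq = inj₂ ¬e

ν-stable-or-grows : ∀ E {a b} → a ≤ b → (cut E b ≡ cut E a × ν E b ≡ ν E a) ⊎ ν E a < ν E b
ν-stable-or-grows E {a} {b} a≤b with m≤n⇒m<n∨m≡n a≤b
... | inj₂ refl = inj₁ (refl , refl)
... | inj₁ (s≤s {n = b′} a≤b′) with ν-stable-or-grows E a≤b′
...   | inj₂ lt = inj₂ (≤-trans lt (ν-ascending E b′))
...   | inj₁ (ceq , neq) with step E b′
...     | fire _ _ eq   = inj₂ (subst₂ _<_ neq (sym eq) ≤-refl)
...     | skip _ ceq′ eq = inj₁ (trans ceq′ ceq , trans eq neq)

-- If the scan does not fire between `a` and the last step before `b`, its last cut is still at most
-- `a`, so monotonicity makes it fire at `b`.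
ν-grows : ∀ {E} → Monotone E → ∀ {a b} → a < b → T (E a b) → ν E a < ν E b
ν-grows {E} mono {a} {suc b} (s≤s a≤b) e with ν-stable-or-grows E a≤b
... | inj₂ lt = ≤-trans lt (ν-ascending E b)
... | inj₁ (ceq , neq) with step E b
...   | fire _ _ eq = subst₂ _<_ neq (sym eq) ≤-refl
...   | skip ¬e _ _ = ⊥-elim (¬e (mono (subst (_≤ a) (sym ceq) (cut≤ E a)) ≤-refl e))

-- Weak duality: every firing of the greedy scan closes a good interval that starts at the previous
-- cut, and `φ` gains at least one across it. The bounds on `ν` in this part come from such
-- potentials.
ν-least : ∀ E (φ : ℕ → ℕ) → (∀ n → φ n ≤ φ (suc n)) →
          (∀ {a b} → a < b → T (E a b) → φ a < φ b) → ∀ n → ν E n ≤ φ n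
ν-least E φ asc grows n = ≤-trans (go n) (ascending⇒mono φ asc (cut≤ E n))
  where
  go : ∀ n → ν E n ≤ φ (cut E n)
  go zero    = z≤n
  go (suc n) with step E n
  ... | fire e ceq neq rewrite ceq | neq = ≤-trans (s≤s (go n)) (grows (s≤s (cut≤ E n)) e)
  ... | skip _ ceq neq rewrite ceq | neq = go n

ν-mono : ∀ {E E′} → Monotone E′ → (∀ a b → T (E a b) → T (E′ a b)) → ∀ n → ν E n ≤ ν E′ n
ν-mono {E} {E′} mono h = ν-least E (ν E′) (ν-ascending E′) (λ a<b e → ν-grows mono a<b (h _ _ e))

ν-empty : ∀ {E} → (∀ a b → ¬ T (E a b)) → ∀ n → ν E n ≡ 0
ν-empty {E} h n = n≤0⇒n≡0 (ν-least E (λ _ → 0) (λ _ → z≤n) (λ _ e → ⊥-elim (h _ _ e)) n)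

-- The sum of the two packing numbers is a potential: a good interval raises one of them and lowers
-- neither.
ν-∪ : ∀ {E E₁ E₂} → Monotone E₁ → Monotone E₂ →
      (∀ a b → T (E a b) → T (E₁ a b) ⊎ T (E₂ a b)) → ∀ n → ν E n ≤ ν E₁ n + ν E₂ n
ν-∪ {E} {E₁} {E₂} m₁ m₂ h =
  ν-least E (λ n → ν E₁ n + ν E₂ n) (λ n → +-mono-≤ (ν-ascending E₁ n) (ν-ascending E₂ n)) grows
  where
  grows : ∀ {a b} → a < b → T (E a b) → ν E₁ a + ν E₂ a < ν E₁ b + ν E₂ b
  grows a<b e with h _ _ e
  ... | inj₁ e₁ = +-mono-<-≤ (ν-grows m₁ a<b e₁) (ν-monoʳ E₂ (<⇒≤ a<b))
  ... | inj₂ e₂ = +-mono-≤-< (ν-monoʳ E₁ (<⇒≤ a<b)) (ν-grows m₂ a<b e₂)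

atLeast-monotone : ∀ s n {E : ℕ → Intervals} → (∀ u → Monotone (E u)) →
                   Monotone (λ a b → atLeast s n (λ u → E u a b))
atLeast-monotone s n mono a′≤a b≤b′ = atLeast-map {s} {n} (λ u → mono u a′≤a b≤b′)

module _ (s t : ℕ) (E : ℕ → Intervals) (E-mono : ∀ u → Monotone (E u)) where

  private
    some many : Intervals
    some a b = atLeast 1 t (λ u → E u a b)
    many a b = atLeast s t (λ u → E u a b)

    some-mono : Monotone some
    some-mono = atLeast-monotone 1 t E-mono

    -- Between two cuts of many, at most s lines are active. Each of these is credited with
    -- the progress of ν some since the last cut, and every line with one unit per cut; by
    -- ν-least the resulting credit φ u dominates ν (E u).
    active : ℕ → ℕ → ℕ → ℕ
    active u a b = ⟦ E u a b ⟧

    gained : ℕ → ℕ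
    gained n = ν some n ∸ ν some (cut many n)

    base : ℕ → ℕ → ℕ
    base u zero    = 0
    base u (suc n) =
      if many (cut many n) (suc n)
      -- The credit is frozen at `n`, one position before the cut. There either fewer than `s` lines
      -- are active or nothing has been gained, whereas at `suc n` at least `s` lines are active;
      -- the missing last step is paid by the new unit of `ν many`.
      then base u n + active u (cut many n) n * gained n
      else base u n

    φ : ℕ → ℕ → ℕ
    φ u n = base u n + ν many n + active u (cut many n) n * gained n

    base-fire : ∀ u n → T (many (cut many n) (suc n)) →
                base u (suc n) ≡ base u n + active u (cut many n) n * gained n
    base-fire u n e with many (cut many n) (suc n)
    ... | true = refl

    base-skip : ∀ u n → ¬ T (many (cut many n) (suc n)) → base u (suc n) ≡ base u n
    base-skip u n ¬e with many (cut many n) (suc n)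
    ... | true  = ⊥-elim (¬e tt)
    ... | false = refl

    φ-fire : ∀ u n → T (many (cut many n) (suc n)) → ν many (suc n) ≡ suc (ν many n) →
             φ u n < φ u (suc n)
    φ-fire u n e neq rewrite base-fire u n e | neq = begin-strict
      b + ν many n + g       ≡⟨ +-assoc b _ g ⟩
      b + (ν many n + g)     ≡⟨ cong (b +_) (+-comm (ν many n) g) ⟩
      b + (g + ν many n)     ≡⟨ +-assoc b g _ ⟨
      b + g + ν many n       <⟨ +-monoʳ-< (b + g) ≤-refl ⟩
      b + g + suc (ν many n) ≤⟨ m≤m+n _ _ ⟩
      _                      ∎
      where
      open ≤-Reasoning
      b = base u n
      g = active u (cut many n) n * gained n

    φ-ascending : ∀ u n → φ u n ≤ φ u (suc n)
    φ-ascending u n with step many n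
    ... | fire e ceq neq = <⇒≤ (φ-fire u n e neq)
    ... | skip ¬e ceq neq rewrite base-skip u n ¬e | ceq | neq =
      +-monoʳ-≤ (base u n + ν many n)
        (*-mono-≤ (⟦⟧-mono (E-mono u ≤-refl (n≤1+n n))) (∸-monoˡ-≤ (ν some (cut many n)) (ν-ascending some n)))

    φ-stable-or-grows : ∀ u {a b} → a ≤ b →
      (cut many b ≡ cut many a × ν many b ≡ ν many a × base u b ≡ base u a) ⊎ φ u a < φ u b
    φ-stable-or-grows u {a} a≤b with m≤n⇒m<n∨m≡n a≤b
    ... | inj₂ refl = inj₁ (refl , refl , refl)
    ... | inj₁ (s≤s {n = b} a≤b′) with φ-stable-or-grows u a≤b′
    ...   | inj₂ lt = inj₂ (≤-trans lt (φ-ascending u b))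
    ...   | inj₁ (ceq , neq , beq) with step many b
    ...     | fire e _ neq′ =
      inj₂ (≤-<-trans (ascending⇒mono (φ u) (φ-ascending u) a≤b′) (φ-fire u b e neq′))
    ...     | skip ¬e ceq′ neq′ = inj₁ (trans ceq′ ceq , trans neq′ neq , trans (base-skip u b ¬e) beq)

    -- While `many` makes no cut, only the last summand of `φ` can move. The interval is good for
    -- line `u`, hence for `some`, so the gain rises; and line `u` is active at `b` because its
    -- interval starts after the last cut.
    φ-grows : ∀ u {a b} → u < t → a < b → T (E u a b) → φ u a < φ u b
    φ-grows u {a} {b} u<t a<b e with φ-stable-or-grows u (<⇒≤ a<b)
    ... | inj₂ lt = lt
    ... | inj₁ (ceq , neq , beq) rewrite ceq | neq | beq =
      +-monoʳ-< (base u a + ν many a) (begin-strict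
        active u p a * (ν some a ∸ ν some p) ≤⟨ *-monoˡ-≤ _ (⟦⟧≤1 (E u p a)) ⟩
        1 * (ν some a ∸ ν some p)            <⟨ *-monoʳ-< 1 (∸-monoˡ-< (ν-grows some-mono a<b hit) (ν-monoʳ some (cut≤ many a))) ⟩
        1 * (ν some b ∸ ν some p)            ≡⟨ cong (_* _) (⟦⟧-T (E-mono u (cut≤ many a) ≤-refl e)) ⟨
        active u p b * (ν some b ∸ ν some p) ∎)
      where
      open ≤-Reasoning
      p = cut many a
      hit : T (some a b)
      hit = ≤⇒≤ᵇ (∃-count (λ u → E u a b) u<t e)

    ν≤φ : ∀ u → u < t → ∀ n → ν (E u) n ≤ φ u n
    ν≤φ u u<t = ν-least (E u) (φ u) (φ-ascending u) (φ-grows u u<t)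

    -- At a cut the gain is zero. Elsewhere `many` fails on the stretch since the last cut, which
    -- means that fewer than `s` lines are active.
    gained-bound : ∀ n → ∑< t (λ u → active u (cut many n) n * gained n) ≤ s * gained n
    gained-bound n with cut-or-false many n
    ... | inj₁ eq rewrite eq | n∸n≡0 (ν some n) | *-zeroʳ s =
      ≤-reflexive (trans (∑<-*ʳ t (λ u → active u n n) 0) (*-zeroʳ (∑< t (λ u → active u n n))))
    ... | inj₂ ¬m rewrite ∑<-*ʳ t (λ u → active u (cut many n) n) (gained n) =
      *-monoˡ-≤ (gained n) (<⇒≤ (≰⇒> {s} {count t (λ u → E u (cut many n) n)} (λ s≤ → ¬m (≤⇒≤ᵇ s≤))))

    gained-sum : ∀ {x} n → x ≤ s * ν some (cut many n) →
                 x + ∑< t (λ u → active u (cut many n) n * gained n) ≤ s * ν some n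
    gained-sum {x} n h = begin
      x + ∑< t (λ u → active u (cut many n) n * gained n) ≤⟨ +-mono-≤ h (gained-bound n) ⟩
      s * ν some (cut many n) + s * gained n              ≡⟨ *-distribˡ-+ s _ _ ⟨
      s * (ν some (cut many n) + gained n)                ≡⟨ cong (s *_) (m+[n∸m]≡n (ν-monoʳ some (cut≤ many n))) ⟩
      s * ν some n                                        ∎
      where open ≤-Reasoning

    base-bound : ∀ n → ∑< t (λ u → base u n) ≤ s * ν some (cut many n)
    base-bound zero    = ≤-trans (≤-reflexive (trans (∑<-const t 0) (*-zeroʳ t))) z≤n
    base-bound (suc n) with step many n
    ... | fire e ceq _ rewrite ceq | ∑<-cong t (λ u → base-fire u n e)
                             | ∑<-+ t (λ u → base u n) (λ u → active u (cut many n) n * gained n) =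
      ≤-trans (gained-sum n (base-bound n)) (*-monoʳ-≤ s (ν-ascending some n))
    ... | skip ¬e ceq _ rewrite ceq | ∑<-cong t (λ u → base-skip u n ¬e) = base-bound n

  -- Summed over the lines, the gains telescope along the cuts to `s * ν some n`, and the unit per
  -- cut is collected by each of the `t` lines. In a contraction the first term becomes the
  -- contracted problem, the second one is left to the halving argument.
  ν-fibres : ∀ n → ∑< t (λ u → ν (E u) n) ≤ s * ν some n + t * ν many n
  ν-fibres n = begin
    ∑< t (λ u → ν (E u) n)
      ≤⟨ ∑<-mono-< t (λ u u<t → ν≤φ u u<t n) ⟩
    ∑< t (λ u → base u n + ν many n + act u)
      ≡⟨ trans (∑<-+ t (λ u → base u n + ν many n) act) (cong (_+ ∑< t act) (∑<-+ t (λ u → base u n) (λ _ → ν many n))) ⟩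
    ∑< t (λ u → base u n) + ∑< t (λ _ → ν many n) + ∑< t act
      ≡⟨ trans (+-assoc bases _ _) (trans (cong (bases +_) (+-comm _ (∑< t act))) (sym (+-assoc bases _ _))) ⟩
    ∑< t (λ u → base u n) + ∑< t act + ∑< t (λ _ → ν many n)
      ≤⟨ +-mono-≤ (gained-sum n (base-bound n)) (≤-reflexive (∑<-const t (ν many n))) ⟩
    s * ν some n + t * ν many n ∎
    where
    open ≤-Reasoning
    bases : ℕ
    bases = ∑< t (λ u → base u n)
    act : ℕ → ℕ
    act u = active u (cut many n) n * gained n

-- Coarsening the line direction

dilate : ℕ → Intervals → Intervals
dilate t E a b = E (a * t) (b * t)

dilate-monotone : ∀ t {E} → Monotone E → Monotone (dilate t E)
dilate-monotone t mono a≤ b≤ = mono (*-monoˡ-≤ t a≤) (*-monoˡ-≤ t b≤)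

⌈_/_⌉ : ℕ → (t : ℕ) .{{_ : NonZero t}} → ℕ
⌈ zero  / t ⌉ = 0
⌈ suc n / t ⌉ = suc (n ℕ./ t)

module _ (t : ℕ) .{{_ : NonZero t}} (E : Intervals) (E-mono : Monotone E) where

  private
    D : Intervals
    D = dilate t E

    D-mono : Monotone D
    D-mono = dilate-monotone t E-mono

    inner : ℕ → ℕ
    inner p = ⟦ D p (suc p) ⟧

    ⌈/⌉-ascending : ∀ n → ⌈ n / t ⌉ ≤ ⌈ suc n / t ⌉
    ⌈/⌉-ascending zero    = z≤n
    ⌈/⌉-ascending (suc n) = s≤s (/-monoˡ-≤ t (n≤1+n n))

    ⌈/⌉≤ : ∀ n → ⌈ n / t ⌉ ≤ suc (n ℕ./ t)
    ⌈/⌉≤ zero    = z≤n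
    ⌈/⌉≤ (suc n) = s≤s (/-monoˡ-≤ t (n≤1+n n))

    <-next : ∀ n → suc n ≤ suc (n ℕ./ t) * t
    <-next n = begin
      suc n               ≡⟨ cong suc (m≡m%n+[m/n]*n n t) ⟩
      suc (n % t) + n ℕ./ t * t ≤⟨ +-monoˡ-≤ (n ℕ./ t * t) (m%n<n n t) ⟩
      t + n ℕ./ t * t       ∎
      where open ≤-Reasoning

    -- An interval inside a block [q t, q t + t) is paid for by a position of that block. Any
    -- other one is paid for by ν D, taken both at ⌊n / t⌋ and at ⌈n / t⌉ because its right
    -- end must be rounded up while its left end is rounded down.
    φ : ℕ → ℕ
    φ n = ∑< n (λ y → inner (y ℕ./ t)) + (ν D (n ℕ./ t) + ν D ⌈ n / t ⌉)

    φ-ascending : ∀ n → φ n ≤ φ (suc n)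
    φ-ascending n = +-mono-≤ (m≤m+n (∑< n (λ y → inner (y ℕ./ t))) _)
      (+-mono-≤ (ν-monoʳ D (/-monoˡ-≤ t (n≤1+n n))) (ν-monoʳ D (⌈/⌉-ascending n)))

    φ-mono : ∀ {m n} → m ≤ n → φ m ≤ φ n
    φ-mono = ascending⇒mono φ φ-ascending

    φ-grows : ∀ {a b} → a < b → T (E a b) → φ a < φ b
    φ-grows {a} {suc b} (s≤s a≤b) e with m≤n⇒m<n∨m≡n (/-monoˡ-≤ t a≤b)
    -- The interval meets two blocks, and the two terms swap roles: the floor term at `a` is
    -- strictly below the ceiling term at `suc b`, and the ceiling term at `a` is at most the floor
    -- term at `suc b`.
    ... | inj₁ lt = +-mono-≤-< (∑<-monoˡ (λ y → inner (y ℕ./ t)) (m≤n⇒m≤1+n a≤b)) (begin-strict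
        ν D (a ℕ./ t) + ν D ⌈ a / t ⌉           <⟨ +-monoˡ-< (ν D ⌈ a / t ⌉) (ν-grows D-mono (m<n⇒m<1+n lt) (E-mono (m/n*n≤m a t) (<-next b) e)) ⟩
        ν D (suc (b ℕ./ t)) + ν D ⌈ a / t ⌉     ≤⟨ +-monoʳ-≤ (ν D (suc (b ℕ./ t))) (ν-monoʳ D (≤-trans (⌈/⌉≤ a) (≤-trans lt (/-monoˡ-≤ t (n≤1+n b))))) ⟩
        ν D (suc (b ℕ./ t)) + ν D (suc b ℕ./ t)   ≡⟨ +-comm (ν D (suc (b ℕ./ t))) _ ⟩
        ν D (suc b ℕ./ t) + ν D (suc (b ℕ./ t))   ∎)
      where open ≤-Reasoning
    ... | inj₂ eq = ≤-trans
        (+-monoˡ-≤ (ν D (a ℕ./ t) + ν D ⌈ a / t ⌉)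
          (≤-reflexive (sym (trans (cong (∑< a (λ y → inner (y ℕ./ t)) +_) (⟦⟧-T chunk)) (+-comm _ 1)))))
        (≤-trans (+-monoʳ-≤ (∑< (suc a) (λ y → inner (y ℕ./ t))) (+-mono-≤ (ν-monoʳ D (/-monoˡ-≤ t (n≤1+n a))) (ν-monoʳ D (⌈/⌉-ascending a))))
          (φ-mono (s≤s a≤b)))
      where
      chunk : T (D (a ℕ./ t) (suc (a ℕ./ t)))
      chunk = E-mono (m/n*n≤m a t) (subst (λ q → suc b ≤ suc q * t) (sym eq) (<-next b)) e

  -- Evaluate the potential at the block boundary `n * t`: a block that contains a good interval is
  -- charged for each of its `t` positions, and floor and ceiling of the quotient are both at most
  -- `n`.
  ν-dilate : ∀ n → ν E (n * t) ≤ t * ∑< n inner + 2 * ν D n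
  ν-dilate n = ≤-trans (ν-least E φ φ-ascending φ-grows (n * t)) (+-mono-≤ (≤-reflexive inners) outers)
    where
    block : ∀ c u → u < t → (c * t + u) ℕ./ t ≡ c
    block c u u<t = trans (+-distrib-/-∣ˡ u (divides-refl c)) (trans (cong₂ _+_ (m*n/n≡m c t) (m<n⇒m/n≡0 u<t)) (+-identityʳ c))
    inners : ∑< (n * t) (λ y → inner (y ℕ./ t)) ≡ t * ∑< n inner
    inners = trans (∑<-blocks n t _) (trans (∑<-cong n (λ c → trans
        (≤-antisym (∑<-mono-< t (λ u u<t → ≤-reflexive (cong inner (block c u u<t))))
                   (∑<-mono-< t (λ u u<t → ≤-reflexive (cong inner (sym (block c u u<t))))))
        (∑<-const t (inner c)))) (∑<-*ˡ n t inner))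
    ceil : ⌈ n * t / t ⌉ ≤ n
    ceil with n * t in eq
    ... | zero  = z≤n
    ... | suc m = m<n*o⇒m/o<n (≤-reflexive (sym eq))
    outers : ν D (n * t ℕ./ t) + ν D ⌈ n * t / t ⌉ ≤ 2 * ν D n
    outers = +-mono-≤ (ν-monoʳ D (≤-reflexive (m*n/n≡m n t))) (≤-trans (ν-monoʳ D ceil) (≤-reflexive (sym (+-identityʳ _))))

-- Interval minors

-- Cut points on one axis, cell `a` being the half-open range from `at a` to `at (suc a)`. An
-- infinite weakly increasing sequence avoids a length index; that the relevant cells are nonempty
-- is ensured by `Hits`.
record Thresholds : Set where
  field
    at        : ℕ → ℕ
    ascending : ∀ a → at a ≤ at (suc a)

  at-mono : ∀ {a b} → a ≤ b → at a ≤ at b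
  at-mono = ascending⇒mono at ascending

open Thresholds

constant : ℕ → Thresholds
constant c = record { at = λ _ → c ; ascending = λ _ → ≤-refl }

consᵗ : ∀ lo θ → lo ≤ at θ 0 → Thresholds
consᵗ lo θ h = record { at = before ; ascending = asc }
  where
  before : ℕ → ℕ
  before zero    = lo
  before (suc a) = at θ a
  asc : ∀ a → before a ≤ before (suc a)
  asc zero    = h
  asc (suc a) = ascending θ a

snoc-at : ℕ → ℕ → (ℕ → ℕ) → ℕ → ℕ
snoc-at ℓ hi f a = if a ≤ᵇ ℓ then f a else hi

snoc-at-≤ : ∀ ℓ hi f {a} → a ≤ ℓ → snoc-at ℓ hi f a ≡ f a
snoc-at-≤ ℓ hi f {a} a≤ℓ with a ≤ᵇ ℓ | ≤⇒≤ᵇ a≤ℓ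
... | true | _ = refl

snoc-at-> : ∀ ℓ hi f {a} → ℓ < a → snoc-at ℓ hi f a ≡ hi
snoc-at-> ℓ hi f {a} ℓ<a with a ≤ᵇ ℓ in eq
... | false = refl
... | true  = ⊥-elim (<⇒≱ ℓ<a (≤ᵇ⇒≤ a ℓ (subst T (sym eq) tt)))

snocᵗ : ∀ ℓ θ hi → at θ ℓ ≤ hi → Thresholds
snocᵗ ℓ θ hi h = record { at = snoc-at ℓ hi (at θ) ; ascending = asc }
  where
  below : ∀ {a} → a ≤ ℓ → snoc-at ℓ hi (at θ) a ≡ at θ a
  below = snoc-at-≤ ℓ hi (at θ)
  above : ∀ {a} → ℓ < a → snoc-at ℓ hi (at θ) a ≡ hi
  above = snoc-at-> ℓ hi (at θ)
  asc : ∀ a → snoc-at ℓ hi (at θ) a ≤ snoc-at ℓ hi (at θ) (suc a)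
  asc a with a ≤? ℓ | suc a ≤? ℓ
  ... | _       | yes sa≤ = subst₂ _≤_ (sym (below (<⇒≤ sa≤))) (sym (below sa≤)) (ascending θ a)
  ... | yes a≤  | no  sa≰ = subst₂ _≤_ (sym (below a≤)) (sym (above (≰⇒> sa≰))) (≤-trans (at-mono θ a≤) h)
  ... | no  a≰  | no  sa≰ = ≤-reflexive (trans (above (≰⇒> a≰)) (sym (above (≰⇒> sa≰))))

InBox : ∀ {D k} → Vec Thresholds D → Vec (Fin k) D → Vec ℕ D → Set
InBox []      []      []      = ⊤
InBox (θ ∷ M) (b ∷ β) (c ∷ x) = (at θ (toℕ b) ≤ c × c < at θ (suc (toℕ b))) × InBox M β x

Family : ℕ → Set
Family D = Vec ℕ D → Intervals

MonotoneFamily : ∀ {D} → Family D → Set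
MonotoneFamily E = ∀ x → Monotone (E x)

Grid : ℕ → Set
Grid D = Vec Thresholds D × Thresholds

-- The axes are not symmetric: on the first `D` axes a point of the cell is chosen, while in the
-- line direction the property is tested on the whole interval between two thresholds.
Hits : ∀ {D} (k l : ℕ) → Grid D → (Vec ℕ D → ℕ → ℕ → Set) → Set
Hits {D} k l (M , θ) P = ∀ (β : Vec (Fin k) D) (a : Fin l) →
  ∃ λ x → InBox M β x × P x (at θ (toℕ a)) (at θ (suc (toℕ a)))

Hits-map : ∀ {D k l} (G : Grid D) {P Q : Vec ℕ D → ℕ → ℕ → Set} →
           (∀ x a b → P x a b → Q x a b) → Hits k l G P → Hits k l G Q
Hits-map G h hits β a with hits β a
... | x , x∈ , p = x , x∈ , h _ _ _ p

Minor : ∀ {D} (k l : ℕ) → Family D → Set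
Minor k l E = ∃ λ G → Hits k l G (λ x a b → T (E x a b))

-- If one half is empty, the other one has everything. Otherwise both are nonempty, and the larger
-- one has at least `s`.
halves : ∀ s cL cR → s + s ≤ cL + cR →
         (s + s ≤ cL ⊎ s + s ≤ cR) ⊎ ((s ≤ cL × 1 ≤ cR) ⊎ (s ≤ cR × 1 ≤ cL))
halves s cL       zero     h = inj₁ (inj₁ (subst (s + s ≤_) (+-identityʳ cL) h))
halves s zero     (suc cR) h = inj₁ (inj₂ h)
halves s (suc cL) (suc cR) h with s ≤? suc cL | s ≤? suc cR
... | yes p | _     = inj₂ (inj₁ (p , s≤s z≤n))
... | no  _ | yes p = inj₂ (inj₂ (p , s≤s z≤n))
... | no  p | no  q = ⊥-elim (<⇒≱ (+-mono-<-≤ (≰⇒> p) (<⇒≤ (≰⇒> q))) h)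

module Halving {D} (k l : ℕ) (Ns : Vec ℕ D) (n F : ℕ)
  (bounded : (E : Family D) → MonotoneFamily E → ¬ Minor (suc k) (suc l) E → ∑□ Ns (λ x → ν (E x) n) ≤ F) where

  Inside : ℕ → ℕ → (ℕ → Family D) → Vec ℕ D → ℕ → ℕ → Set
  Inside lo hi E x i j = ∃ λ c → (lo ≤ c × c < hi) × T (E c x i j)

  -- Consecutive ranges of one extra coordinate that all share a single grid `G`. With that
  -- coordinate inserted as a new axis, a chain of `suc k` ranges is a minor one dimension higher.
  Chain : ℕ → ℕ → ℕ → (ℕ → Family D) → Set
  Chain ℓ lo hi E = ∃ λ (θ : Thresholds) → lo ≤ at θ 0 × at θ ℓ ≤ hi × ∃ λ G → ∀ a → a < ℓ →
    Hits (suc k) (suc l) G (Inside (at θ a) (at θ (suc a)) E)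

  hull : ℕ → ℕ → ℕ → (ℕ → Family D) → Family D
  hull s lo len E x a b = atLeast s len (λ u → E (lo + u) x a b)

  hull-monotone : ∀ s lo len E → (∀ c → MonotoneFamily (E c)) → MonotoneFamily (hull s lo len E)
  hull-monotone s lo len E mono x = atLeast-monotone s len (λ u → mono (lo + u) x)

  widen : ∀ {ℓ lo lo′ hi hi′} E → lo′ ≤ lo → hi ≤ hi′ → Chain ℓ lo hi E → Chain ℓ lo′ hi′ E
  widen E lo≤ hi≤ (θ , lo≤θ , θ≤hi , G , hits) = θ , ≤-trans lo≤ lo≤θ , ≤-trans θ≤hi hi≤ , G , hits

  infixl 6 _⊓ᶠ_
  _⊓ᶠ_ : (ℕ → Family D) → Family D → ℕ → Family D
  (E ⊓ᶠ A) c x a b = E c x a b ∧ A x a b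

  forget : ∀ {lo hi} E A x i j → Inside lo hi (E ⊓ᶠ A) x i j → Inside lo hi E x i j
  forget E A x i j (c , c∈ , e) = c , c∈ , proj₁ (Equivalence.to (T-∧ {E c x i j}) e)

  ⊓ᶠ-monotone : ∀ E A → (∀ c → MonotoneFamily (E c)) → MonotoneFamily A → ∀ c → MonotoneFamily ((E ⊓ᶠ A) c)
  ⊓ᶠ-monotone E A mE mA c x a≤ b≤ t with Equivalence.to T-∧ t
  ... | e , f = Equivalence.from T-∧ (mE c x a≤ b≤ e , mA x a≤ b≤ f)

  -- The lines of the left half are kept only on intervals that are also good for some line of the
  -- right half. Hence the hits in range 0 of the chain supply, at the same `x` and on the same
  -- interval, hits in the right half, which is appended as one more range.
  extendʳ : ∀ {ℓ lo len} E → Chain (suc ℓ) lo (lo + len) (E ⊓ᶠ hull 1 (lo + len) len E) →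
            Chain (suc (suc ℓ)) lo (lo + len + len) E
  extendʳ {ℓ} {lo} {len} E (θ , lo≤θ , θ≤mid , G , hits) =
    θ′ , lo≤θ , ≤-reflexive (snoc-at-> (suc ℓ) (lo + len + len) (at θ) ≤-refl) , G , hits′
    where
    θ′ : Thresholds
    θ′ = snocᵗ (suc ℓ) θ (lo + len + len) (≤-trans θ≤mid (m≤m+n (lo + len) len))
    hits′ : ∀ a → a < suc (suc ℓ) →
      Hits (suc k) (suc l) G (Inside (at θ′ a) (at θ′ (suc a)) E)
    hits′ a (s≤s a≤) with m≤n⇒m<n∨m≡n a≤
    ... | inj₁ a< rewrite snoc-at-≤ (suc ℓ) (lo + len + len) (at θ) a≤
                        | snoc-at-≤ (suc ℓ) (lo + len + len) (at θ) a< =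
      Hits-map G (forget E (hull 1 (lo + len) len E)) (hits a a<)
    ... | inj₂ refl rewrite snoc-at-≤ (suc ℓ) (lo + len + len) (at θ) a≤
                          | snoc-at-> (suc ℓ) (lo + len + len) (at θ) (≤-refl {suc (suc ℓ)}) =
      Hits-map G right (hits 0 (s≤s z≤n))
      where
      right : ∀ x i j → Inside (at θ 0) (at θ 1) (E ⊓ᶠ hull 1 (lo + len) len E) x i j →
              Inside (at θ (suc ℓ)) (lo + len + len) E x i j
      right x i j (c , _ , e)
        with count-∃ len (λ u → E (lo + len + u) x i j) (≤ᵇ⇒≤ 1 _ (proj₂ (Equivalence.to (T-∧ {E c x i j}) e)))
      ... | u , u< , e′ = lo + len + u , (≤-trans θ≤mid (m≤m+n _ u) , +-monoʳ-< (lo + len) u<) , e′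

  extendˡ : ∀ {ℓ lo len} E → Chain (suc ℓ) (lo + len) (lo + len + len) (E ⊓ᶠ hull 1 lo len E) →
            Chain (suc (suc ℓ)) lo (lo + len + len) E
  extendˡ {ℓ} {lo} {len} E (θ , mid≤θ , θ≤hi , G , hits) =
    θ′ , ≤-refl , θ≤hi , G , hits′
    where
    θ′ : Thresholds
    θ′ = consᵗ lo θ (≤-trans (m≤m+n lo len) mid≤θ)
    hits′ : ∀ a → a < suc (suc ℓ) →
      Hits (suc k) (suc l) G (Inside (at θ′ a) (at θ′ (suc a)) E)
    hits′ (suc a) (s≤s a<) =
      Hits-map G (forget E (hull 1 lo len E)) (hits a a<)
    hits′ zero _ = Hits-map G left (hits 0 (s≤s z≤n))
      where
      left : ∀ x i j → Inside (at θ 0) (at θ 1) (E ⊓ᶠ hull 1 lo len E) x i j →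
             Inside lo (at θ 0) E x i j
      left x i j (c , _ , e)
        with count-∃ len (λ u → E (lo + u) x i j) (≤ᵇ⇒≤ 1 _ (proj₂ (Equivalence.to (T-∧ {E c x i j}) e)))
      ... | u , u< , e′ = lo + u , (m≤m+n lo u , ≤-trans (+-monoʳ-< lo u<) mid≤θ) , e′

  count-∧ : ∀ len (p : ℕ → Bool) {b} → T b → count len (λ u → p u ∧ b) ≡ count len p
  count-∧ len p {true} _ = ∑<-cong len (λ u → cong ⟦_⟧ (∧-identityʳ (p u)))

  module Split (ℓ lo len : ℕ) (E : ℕ → Family D) (mono : ∀ c → MonotoneFamily (E c)) where

    mid s : ℕ
    mid = lo + len
    s   = 2 ^ ℓ

    EL ER : ℕ → Family D
    EL = E ⊓ᶠ hull 1 mid len E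
    ER = E ⊓ᶠ hull 1 lo len E

    -- The ways in which `2 ^ suc ℓ` good lines can lie in the two halves: all in one half, or at
    -- least `2 ^ ℓ` in one and at least one in the other.
    L U LR RL : Family D
    L  = hull (2 ^ suc ℓ) lo len E
    U  = hull (2 ^ suc ℓ) mid len E
    LR = hull s lo len EL
    RL = hull s mid len ER

    EL-mono : ∀ c → MonotoneFamily (EL c)
    EL-mono = ⊓ᶠ-monotone E _ mono (hull-monotone 1 mid len E mono)
    ER-mono : ∀ c → MonotoneFamily (ER c)
    ER-mono = ⊓ᶠ-monotone E _ mono (hull-monotone 1 lo len E mono)

    double : ∀ {c} → s + s ≤ c → 2 ^ suc ℓ ≤ c
    double {c} = subst (_≤ c) (cong (s +_) (sym (+-identityʳ s)))

    cases : ∀ x a b → T (hull (2 ^ suc ℓ) lo (len + len) E x a b) →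
            (T (L x a b) ⊎ T (U x a b)) ⊎ (T (LR x a b) ⊎ T (RL x a b))
    cases x a b h
      with halves s (count len (λ u → E (lo + u) x a b)) (count len (λ u → E (mid + u) x a b))
             (subst₂ _≤_ {2 ^ suc ℓ} {s + s} {count (len + len) (λ u → E (lo + u) x a b)} (cong (s +_) (+-identityʳ s))
               (trans (∑<-split len len _)
                 (cong (count len (λ u → E (lo + u) x a b) +_)
                   (∑<-cong len (λ u → cong (λ c → ⟦ E c x a b ⟧) (sym (+-assoc lo len u))))))
               (≤ᵇ⇒≤ _ _ h))
    ... | inj₁ (inj₁ p) = inj₁ (inj₁ (≤⇒≤ᵇ (double p)))
    ... | inj₁ (inj₂ p) = inj₁ (inj₂ (≤⇒≤ᵇ (double p)))
    ... | inj₂ (inj₁ (p , q)) = inj₂ (inj₁ (≤⇒≤ᵇ (subst (s ≤_) (sym (count-∧ len _ (≤⇒≤ᵇ q))) p)))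
    ... | inj₂ (inj₂ (p , q)) = inj₂ (inj₂ (≤⇒≤ᵇ (subst (s ≤_) (sym (count-∧ len _ (≤⇒≤ᵇ q))) p)))

    ∪-monotone : ∀ {A B : Intervals} → Monotone A → Monotone B → Monotone (λ a b → A a b ∨ B a b)
    ∪-monotone mA mB a≤ b≤ t with Equivalence.to T-∨ t
    ... | inj₁ p = Equivalence.from T-∨ (inj₁ (mA a≤ b≤ p))
    ... | inj₂ p = Equivalence.from T-∨ (inj₂ (mB a≤ b≤ p))

    pointwise : ∀ x → ν (hull (2 ^ suc ℓ) lo (len + len) E x) n ≤
                      (ν (L x) n + ν (U x) n) + (ν (LR x) n + ν (RL x) n)
    pointwise x = ≤-trans
      (ν-∪ {E₁ = LoR} {E₂ = LRoRL} (∪-monotone mL mR) (∪-monotone mLR mRL) cases′ n)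
      (+-mono-≤ (ν-∪ mL mR (λ a b → Equivalence.to T-∨) n) (ν-∪ mLR mRL (λ a b → Equivalence.to T-∨) n))
      where
      mL : Monotone (L x)
      mL = hull-monotone (2 ^ suc ℓ) lo len E mono x
      mR : Monotone (U x)
      mR = hull-monotone (2 ^ suc ℓ) mid len E mono x
      mLR : Monotone (LR x)
      mLR = hull-monotone s lo len EL EL-mono x
      mRL : Monotone (RL x)
      mRL = hull-monotone s mid len ER ER-mono x
      LoR LRoRL : Intervals
      LoR   a b = L x a b ∨ U x a b
      LRoRL a b = LR x a b ∨ RL x a b
      cases′ : ∀ a b → T (hull (2 ^ suc ℓ) lo (len + len) E x a b) → T (LoR a b) ⊎ T (LRoRL a b)
      cases′ a b h with cases x a b h
      ... | inj₁ p = inj₁ (Equivalence.from T-∨ p)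
      ... | inj₂ p = inj₂ (Equivalence.from T-∨ p)

    total : ∀ {c} → ∑□ Ns (λ x → ν (L x) n) ≤ c → ∑□ Ns (λ x → ν (U x) n) ≤ c →
            ∑□ Ns (λ x → ν (LR x) n) ≤ c → ∑□ Ns (λ x → ν (RL x) n) ≤ c →
            ∑□ Ns (λ x → ν (hull (2 ^ suc ℓ) lo (len + len) E x) n) ≤ (c + c) + (c + c)
    total {c} h₁ h₂ h₃ h₄ = begin
      _ ≤⟨ ∑□-mono Ns pointwise ⟩
      _ ≡⟨ ∑□-+ Ns _ _ ⟩
      _ ≡⟨ cong₂ _+_ (∑□-+ Ns _ _) (∑□-+ Ns _ _) ⟩
      _ ≤⟨ +-mono-≤ (+-mono-≤ h₁ h₂) (+-mono-≤ h₃ h₄) ⟩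
      _ ∎
      where open ≤-Reasoning

  -- Halving the block leaves four subproblems, whence the factor 4 for each step of `r`: one for
  -- each half with the same `ℓ`, and two with `ℓ` lowered by one, whose chains `extendʳ` and
  -- `extendˡ` lengthen again. For `ℓ = 0` a minor of the hull is a chain of one range, so the bound
  -- in dimension `D` applies; for `r = 0` a single line cannot supply two good lines.
  halving : ∀ r ℓ lo E → (∀ c → MonotoneFamily (E c)) → ¬ Chain (suc ℓ) lo (lo + 2 ^ r) E →
            ∑□ Ns (λ x → ν (hull (2 ^ ℓ) lo (2 ^ r) E x) n) ≤ (2 ^ r * 2 ^ r) * F
  halving r zero lo E mono ¬chain = ≤-trans
    (bounded (hull 1 lo (2 ^ r) E) (hull-monotone 1 lo (2 ^ r) E mono) ¬minor)
    (m≤n*m F (2 ^ r * 2 ^ r) {{m*n≢0 (2 ^ r) (2 ^ r) {{m^n≢0 2 r}} {{m^n≢0 2 r}}}})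
    where
    θ : Thresholds
    θ = consᵗ lo (constant (lo + 2 ^ r)) (m≤m+n lo _)
    ¬minor : ¬ Minor (suc k) (suc l) (hull 1 lo (2 ^ r) E)
    ¬minor (G , hits) = ¬chain (θ , ≤-refl , ≤-refl , G , λ { zero _ → Hits-map G single hits ; (suc _) (s≤s ()) })
      where
      single : ∀ x i j → T (hull 1 lo (2 ^ r) E x i j) →
               Inside lo (lo + 2 ^ r) E x i j
      single x i j h with count-∃ (2 ^ r) (λ u → E (lo + u) x i j) (≤ᵇ⇒≤ 1 _ h)
      ... | u , u< , e = lo + u , (m≤m+n lo u , +-monoʳ-< lo u<) , e
  halving zero (suc ℓ) lo E mono ¬chain = ≤-trans
    (≤-trans (∑□-mono Ns (λ x → ≤-reflexive (ν-empty (none x) n))) (≤-reflexive (∑□-zero Ns))) z≤n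
    where
    none : ∀ x a b → ¬ T (hull (2 ^ suc ℓ) lo 1 E x a b)
    none x a b h = <⇒≱ (*-monoʳ-≤ 2 (m^n>0 2 ℓ))
      (≤-trans (≤ᵇ⇒≤ (2 ^ suc ℓ) _ h) (⟦⟧≤1 (E (lo + 0) x a b)))
  halving (suc r) (suc ℓ) lo E mono ¬chain rewrite +-identityʳ (2 ^ r) = ≤-trans
    (total (halving r (suc ℓ) lo E mono (¬chain ∘ widen E ≤-refl hi≤))
           (halving r (suc ℓ) mid E mono (¬chain ∘ widen E (m≤m+n lo len) (≤-reflexive assoc)))
           (halving r ℓ lo EL EL-mono (¬chain ∘ widen E ≤-refl (≤-reflexive assoc) ∘ extendʳ E))
           (halving r ℓ mid ER ER-mono (¬chain ∘ widen E ≤-refl (≤-reflexive assoc) ∘ extendˡ E)))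
    (≤-reflexive (solve 2 (λ h F → ((h :* h :* F :+ h :* h :* F) :+ (h :* h :* F :+ h :* h :* F))
                                   := (h :+ h) :* (h :+ h) :* F) refl len F))
    where
    open +-*-Solver
    len : ℕ
    len = 2 ^ r
    open Split ℓ lo len E mono
    assoc : lo + len + len ≡ lo + (len + len)
    assoc = +-assoc lo len len
    hi≤ : lo + len ≤ lo + (len + len)
    hi≤ = +-monoʳ-≤ lo (m≤m+n len len)

-- Contraction of blocks

updateAt-insertAt : ∀ {A : Set} {n} (xs : Vec A n) m (x : A) (f : A → A) →
                    updateAt (insertAt xs m x) m f ≡ insertAt xs m (f x)
updateAt-insertAt xs       zero    x f = refl
updateAt-insertAt (y ∷ xs) (suc m) x f = cong (y ∷_) (updateAt-insertAt xs m x f)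

InBox-insertAt : ∀ {D k} (M : Vec Thresholds D) (β : Vec (Fin k) (suc D)) x m θ c →
                 at θ (toℕ (lookup β m)) ≤ c → c < at θ (suc (toℕ (lookup β m))) →
                 InBox M (removeAt β m) x → InBox (insertAt M m θ) β (insertAt x m c)
InBox-insertAt M       (b ∷ β)      x       zero    θ c lo hi x∈ = (lo , hi) , x∈
InBox-insertAt (_ ∷ M) (b ∷ β@(_ ∷ _)) (_ ∷ x) (suc m) θ c lo hi (c∈ , x∈) =
  c∈ , InBox-insertAt M β x m θ c lo hi x∈

scaleᵗ : ℕ → Thresholds → Thresholds
scaleᵗ t θ = record { at = λ a → at θ a * t ; ascending = λ a → *-monoˡ-≤ t (ascending θ a) }

refine : ∀ {b c t u} → c < b → u < t → c * t + u < b * t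
refine {b} {c} {t} {u} c<b u<t = ≤-trans
  (subst (suc (c * t + u) ≤_) (+-comm (c * t) t) (+-monoʳ-< (c * t) u<t)) (*-monoˡ-≤ t c<b)

InBox-refine : ∀ {D k} (M : Vec Thresholds D) (β : Vec (Fin k) D) x m t u → u < t → InBox M β x →
               InBox (updateAt M m (scaleᵗ t)) β (updateAt x m (λ c → c * t + u))
InBox-refine (θ ∷ M) (b ∷ β) (c ∷ x) zero    t u u<t ((lo , hi) , x∈) =
  (≤-trans (*-monoˡ-≤ t lo) (m≤m+n _ u) , refine hi u<t) , x∈
InBox-refine (θ ∷ M) (b ∷ β) (c ∷ x) (suc m) t u u<t (c∈ , x∈) = c∈ , InBox-refine M β x m t u u<t x∈

coarsen : ∀ {D} → Fin D → ℕ → Family D → Family D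
coarsen m t E x a b = atLeast 1 t (λ u → E (updateAt x m (λ c → c * t + u)) a b)

coarsen-monotone : ∀ {D} m t {E : Family D} → MonotoneFamily E → MonotoneFamily (coarsen m t E)
coarsen-monotone m t mono x = atLeast-monotone 1 t (λ u → mono _)

-- Scale the thresholds of axis `m` by `t`. A hit in a contracted cell comes from some line of its
-- block, and the entire block lies in the scaled cell.
Minor-coarsen : ∀ {D k l} m t (E : Family D) → Minor k l (coarsen m t E) → Minor k l E
Minor-coarsen m t E ((M , θ) , hits) = (updateAt M m (scaleᵗ t) , θ) , hits′
  where
  hits′ : Hits _ _ (updateAt M m (scaleᵗ t) , θ) (λ x a b → T (E x a b))
  hits′ β a with hits β a
  ... | x , x∈ , h with count-∃ t (λ u → E (updateAt x m (λ c → c * t + u)) _ _) (≤ᵇ⇒≤ 1 _ h)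
  ...   | u , u<t , e = _ , InBox-refine M β x m t u u<t x∈ , e

-- Families live on all of the natural numbers, and minors are excluded everywhere, while the sum
-- extends over a box only. A bound for a box therefore holds for every smaller box.
BoundedBox : ∀ {D} (k l : ℕ) → Vec ℕ D → ℕ → ℕ → Set
BoundedBox {D} k l Ns n F = (E : Family D) → MonotoneFamily E → ¬ Minor k l E → ∑□ Ns (λ x → ν (E x) n) ≤ F

record Bounded (k l D N n F : ℕ) : Set where
  constructor bounded
  field
    bound : BoundedBox k l (replicate D N) n F

open Bounded

module Contraction {D} (k l r N n B : ℕ) (facet : Bounded (suc k) (suc l) D (N * 2 ^ r) n B) where

  private
    t loss : ℕ
    t    = 2 ^ r
    loss = t * (N * ((t * t) * B))

  facet-box : ∀ {Ns : Vec ℕ D} → Pointwise _≤_ Ns (replicate D (N * t)) → BoundedBox (suc k) (suc l) Ns n B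
  facet-box Ns≤ E mono ¬minor = ≤-trans (∑□-monoˡ _ Ns≤) (bound facet E mono ¬minor)

  -- Apply `ν-fibres` with `s = 2 ^ k` to each slab of `t` consecutive coordinates. The stretches on
  -- which at least `2 ^ k` lines of the slab are good are bounded by `halving` through the facet
  -- bound `B`; the `N` slabs together give `loss`.
  contract-axis : ∀ (Ns : Vec ℕ D) m → Pointwise _≤_ Ns (replicate D (N * t)) →
                  ∀ E → MonotoneFamily E → ¬ Minor (suc k) (suc l) E →
                  ∑□ (insertAt Ns m (N * t)) (λ x → ν (E x) n) ≤
                  2 ^ k * ∑□ (insertAt Ns m N) (λ x → ν (coarsen m t E x) n) + loss
  contract-axis Ns m Ns≤ E mono ¬minor = begin
    ∑□ (insertAt Ns m (N * t)) (λ x → ν (E x) n)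
      ≡⟨ trans (∑□-insertAt Ns m (N * t) _) (∑<-blocks N t _) ⟩
    ∑< N (λ c → ∑< t (λ u → ∑□ Ns (λ x → ν (Eₘ (c * t + u) x) n)))
      ≤⟨ ∑<-mono N slab ⟩
    ∑< N (λ c → 2 ^ k * ∑□ Ns (λ x → ν (coarsen m t E (insertAt x m c)) n) + t * ((t * t) * B))
      ≡⟨ ∑<-+ N (λ c → 2 ^ k * ∑□ Ns (λ x → ν (coarsen m t E (insertAt x m c)) n)) _ ⟩
    ∑< N (λ c → 2 ^ k * ∑□ Ns (λ x → ν (coarsen m t E (insertAt x m c)) n)) + ∑< N (λ _ → t * ((t * t) * B))
      ≡⟨ cong₂ _+_ (trans (∑<-*ˡ N (2 ^ k) _) (cong (2 ^ k *_) (sym (∑□-insertAt Ns m N _))))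
                   (trans (∑<-const N _) (trans (sym (*-assoc N t _)) (trans (cong (_* ((t * t) * B)) (*-comm N t)) (*-assoc t N _)))) ⟩
    2 ^ k * ∑□ (insertAt Ns m N) (λ x → ν (coarsen m t E x) n) + loss ∎
    where
    open ≤-Reasoning
    open Halving k l Ns n B (facet-box Ns≤)

    Eₘ : ℕ → Family D
    Eₘ c x = E (insertAt x m c)

    Eₘ-mono : ∀ c → MonotoneFamily (Eₘ c)
    Eₘ-mono c x = mono (insertAt x m c)

    ¬chain : ∀ lo hi → ¬ Chain (suc k) lo hi Eₘ
    -- The ranges of the chain become the cells of axis `m`; since the grid is common to all of
    -- them, every cell of the enlarged grid is hit.
    ¬chain lo hi (θ , _ , _ , (M , q) , hits) = ¬minor ((insertAt M m θ , q) , hits′)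
      where
      hits′ : Hits (suc k) (suc l) (insertAt M m θ , q) (λ x a b → T (E x a b))
      hits′ β a with hits (toℕ (lookup β m)) (toℕ<n _) (removeAt β m) a
      ... | x , x∈ , c , (lo , hi) , e = insertAt x m c , InBox-insertAt M β x m θ c lo hi x∈ , e

    coarse : ∀ c x → ν (hull 1 (c * t) t Eₘ x) n ≤ ν (coarsen m t E (insertAt x m c)) n
    coarse c x = ν-mono (coarsen-monotone m t mono _)
      (λ a b → atLeast-map {1} {t} (λ u → subst (λ z → T (E z a b)) (sym (updateAt-insertAt x m c _)))) n

    slab : ∀ c → ∑< t (λ u → ∑□ Ns (λ x → ν (Eₘ (c * t + u) x) n)) ≤
                 2 ^ k * ∑□ Ns (λ x → ν (coarsen m t E (insertAt x m c)) n) + t * ((t * t) * B)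
    slab c = begin
      ∑< t (λ u → ∑□ Ns (λ x → ν (Eₘ (c * t + u) x) n))
        ≡⟨ ∑<-∑□-swap t Ns _ ⟩
      ∑□ Ns (λ x → ∑< t (λ u → ν (Eₘ (c * t + u) x) n))
        ≤⟨ ∑□-mono Ns (λ x → ν-fibres (2 ^ k) t (λ u → Eₘ (c * t + u) x) (λ u → Eₘ-mono (c * t + u) x) n) ⟩
      ∑□ Ns (λ x → 2 ^ k * ν (hull 1 (c * t) t Eₘ x) n + t * ν (hull (2 ^ k) (c * t) t Eₘ x) n)
        ≡⟨ trans (∑□-+ Ns _ _) (cong₂ _+_ (∑□-*ˡ Ns (2 ^ k) _) (∑□-*ˡ Ns t _)) ⟩
      2 ^ k * ∑□ Ns (λ x → ν (hull 1 (c * t) t Eₘ x) n) + t * ∑□ Ns (λ x → ν (hull (2 ^ k) (c * t) t Eₘ x) n)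
        ≤⟨ +-mono-≤ (*-monoʳ-≤ (2 ^ k) (∑□-mono Ns (coarse c)))
                    (*-monoʳ-≤ t (halving r k (c * t) Eₘ Eₘ-mono (¬chain _ _))) ⟩
      2 ^ k * ∑□ Ns (λ x → ν (coarsen m t E (insertAt x m c)) n) + t * ((t * t) * B) ∎

-- Mixed i N t Ns: the box Ns has i sides equal to N * t and all others equal to N.
data Mixed : ∀ {D} → ℕ → ℕ → ℕ → Vec ℕ D → Set where
  done : ∀ {D N t} → Mixed 0 N t (replicate D N)
  axis : ∀ {D i N t} {Ns : Vec ℕ D} (m : Fin (suc D)) → Pointwise _≤_ Ns (replicate D (N * t)) →
         Mixed i N t (insertAt Ns m N) → Mixed (suc i) N t (insertAt Ns m (N * t))

module _ {N t : ℕ} (N≤ : N ≤ N * t) where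

  Mixed-∷ : ∀ {D i} {Ns : Vec ℕ D} → Mixed i N t Ns → Mixed i N t (N ∷ Ns)
  Mixed-∷ done           = done
  Mixed-∷ (axis m ≤Nt μ) = axis (suc m) (N≤ ∷ ≤Nt) (Mixed-∷ μ)

  Mixed-cube : ∀ D → Mixed D N t (replicate D (N * t))
  Mixed-cube zero    = done
  Mixed-cube (suc D) = axis zero (Pointwise.refl ≤-refl) (Mixed-∷ (Mixed-cube D))

module _ {D k l r N n B F : ℕ} (facet : Bounded (suc k) (suc l) D (N * 2 ^ r) n B)
         (small : Bounded (suc k) (suc l) (suc D) N n F) where

  private
    loss : ℕ
    loss = 2 ^ r * (N * ((2 ^ r * 2 ^ r) * B))

    contract-mixed : ∀ {D′ i} {Ns : Vec ℕ D′} → Mixed i N (2 ^ r) Ns → D′ ≡ suc D →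
                     BoundedBox (suc k) (suc l) Ns n ((2 ^ k) ^ i * F + i * ((2 ^ k) ^ i * loss))
    contract-mixed done refl E mono ¬minor =
      ≤-trans (bound small E mono ¬minor) (≤-reflexive (sym (trans (+-identityʳ _) (*-identityˡ F))))
    contract-mixed (axis {i = i} {Ns = Ns} m Ns≤ μ) refl E mono ¬minor = begin
      ∑□ (insertAt Ns m (N * 2 ^ r)) (λ x → ν (E x) n)
        ≤⟨ contract-axis Ns m Ns≤ E mono ¬minor ⟩
      s * ∑□ (insertAt Ns m N) (λ x → ν (coarsen m (2 ^ r) E x) n) + loss
        ≤⟨ +-monoˡ-≤ loss (*-monoʳ-≤ s (contract-mixed μ refl (coarsen m (2 ^ r) E)
             (coarsen-monotone m (2 ^ r) mono) (¬minor ∘ Minor-coarsen m (2 ^ r) E))) ⟩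
      s * (s ^ i * F + i * (s ^ i * loss)) + loss
        ≡⟨ cong (_+ loss) (trans (*-distribˡ-+ s _ _) (cong₂ _+_ (sym (*-assoc s (s ^ i) F)) swap)) ⟩
      s ^ suc i * F + i * (s ^ suc i * loss) + loss
        ≤⟨ +-monoʳ-≤ (s ^ suc i * F + i * (s ^ suc i * loss)) (m≤n*m loss (s ^ suc i) {{m^n≢0 s (suc i) {{m^n≢0 2 k}}}}) ⟩
      s ^ suc i * F + i * (s ^ suc i * loss) + s ^ suc i * loss
        ≡⟨ trans (+-assoc (s ^ suc i * F) _ _) (cong (s ^ suc i * F +_) (+-comm (i * (s ^ suc i * loss)) _)) ⟩
      s ^ suc i * F + suc i * (s ^ suc i * loss) ∎
      where
      open ≤-Reasoning
      open Contraction k l r N n B facet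
      s : ℕ
      s = 2 ^ k
      swap : s * (i * (s ^ i * loss)) ≡ i * (s ^ suc i * loss)
      swap = trans (sym (*-assoc s i _)) (trans (cong (_* (s ^ i * loss)) (*-comm s i))
             (trans (*-assoc i s _) (cong (i *_) (sym (*-assoc s (s ^ i) loss)))))

  -- The axes are contracted one after another, each at a factor `2 ^ k` and one further loss. All
  -- facets on the way fit into the cube of side `N * 2 ^ r`, and each loss is charged with the full
  -- power of `2 ^ k`.
  contract : Bounded (suc k) (suc l) (suc D) (N * 2 ^ r) n
               ((2 ^ k) ^ suc D * F + suc D * ((2 ^ k) ^ suc D * (2 ^ r * (N * ((2 ^ r * 2 ^ r) * B)))))
  contract = bounded (contract-mixed (Mixed-cube (m≤m*n N (2 ^ r) {{m^n≢0 2 r}}) (suc D)) refl)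

-- Bounds in terms of the dimension

-- The thresholds are 0 followed by the successive cuts. They turn a large packing on a single line
-- into a grid, which settles dimension zero.
ν-thresholds : ∀ {E} → Monotone E → ∀ n → ∃ λ θ → at θ (ν E n) ≤ cut E n ×
               (∀ a → a < ν E n → T (E (at θ a) (at θ (suc a))))
ν-thresholds {E} mono zero    = constant 0 , ≤-refl , λ _ ()
ν-thresholds {E} mono (suc n) with ν-thresholds mono n | step E n
... | θ , θ≤ , E-θ | skip _ ceq neq rewrite ceq | neq = θ , θ≤ , E-θ
... | θ , θ≤ , E-θ | fire e ceq neq rewrite ceq | neq =
  θ′ , ≤-reflexive (snoc-at-> c (suc n) (at θ) ≤-refl) , E-θ′
  where
  c : ℕ
  c = ν E n
  θ′ : Thresholds
  θ′ = snocᵗ c θ (suc n) (≤-trans θ≤ (m≤n⇒m≤1+n (cut≤ E n)))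
  E-θ′ : ∀ a → a < suc c → T (E (at θ′ a) (at θ′ (suc a)))
  E-θ′ a (s≤s a≤c) with m≤n⇒m<n∨m≡n a≤c
  ... | inj₁ a<c rewrite snoc-at-≤ c (suc n) (at θ) a≤c | snoc-at-≤ c (suc n) (at θ) a<c = E-θ a a<c
  ... | inj₂ refl rewrite snoc-at-≤ c (suc n) (at θ) a≤c | snoc-at-> c (suc n) (at θ) (≤-refl {suc c}) =
    mono θ≤ ≤-refl e

bounded-line : ∀ k l N n → Bounded k (suc l) 0 N n l
bounded-line k l N n .bound E mono ¬minor with ν (E []) n ≤? l
... | yes ≤l = ≤l
... | no  ≰l with ν-thresholds (mono []) n
...   | θ , _ , E-θ with () ← ¬minor (([] , θ) , λ { [] a → [] , tt , E-θ (toℕ a) (≤-trans (toℕ<n a) (≰⇒> ≰l)) })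

ν-1 : ∀ E → ν E 1 ≡ ⟦ E 0 1 ⟧
ν-1 E with E 0 1
... | true  = refl
... | false = refl

-- Intervals with a prescribed number of ones

within : ℕ → (ℕ → Bool) → Intervals
within s p a b = atLeast s b (λ y → (a ≤ᵇ y) ∧ p y)

within-monotone : ∀ s p → Monotone (within s p)
within-monotone s p {a} {a′} {b} {b′} a′≤a b≤b′ h = ≤⇒≤ᵇ (begin
  s                                 ≤⟨ ≤ᵇ⇒≤ s _ h ⟩
  count b  (λ y → (a  ≤ᵇ y) ∧ p y)  ≤⟨ ∑<-monoˡ _ b≤b′ ⟩
  count b′ (λ y → (a  ≤ᵇ y) ∧ p y)  ≤⟨ ∑<-mono b′ (λ y → ⟦⟧-mono (shrink y)) ⟩
  count b′ (λ y → (a′ ≤ᵇ y) ∧ p y)  ∎)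
  where
  open ≤-Reasoning
  shrink : ∀ y → T ((a ≤ᵇ y) ∧ p y) → T ((a′ ≤ᵇ y) ∧ p y)
  shrink y t with Equivalence.to T-∧ t
  ... | a≤y , py = Equivalence.from T-∧ (≤⇒≤ᵇ (≤-trans a′≤a (≤ᵇ⇒≤ a y a≤y)) , py)

IncreasingBelow : ℕ → (ℕ → ℕ) → Set
IncreasingBelow s y = ∀ {i i′} → i < i′ → i′ < s → y i < y i′

select : ∀ s n p → s ≤ count n p →
         ∃ λ y → (∀ i → i < s → y i < n × T (p (y i))) × IncreasingBelow s y
select zero    n       p h = (λ i → i) , (λ _ ()) , λ _ ()
select (suc s) (suc n) p h with p n in eq
... | false with select (suc s) n p (subst (suc s ≤_) (+-identityʳ _) h)
...   | y , y∈ , inc = y , (λ i i< → m<n⇒m<1+n (proj₁ (y∈ i i<)) , proj₂ (y∈ i i<)) , inc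
select (suc s) (suc n) p h | true with select s n p (s≤s⁻¹ (subst (suc s ≤_) (+-comm _ 1) h))
...   | y , y∈ , inc = y′ , y′∈ , inc′
  where
  y′ : ℕ → ℕ
  y′ i = if i <ᵇ s then y i else n
  view : ∀ i → i < suc s → (i < s × y′ i ≡ y i) ⊎ (i ≡ s × y′ i ≡ n)
  view i (s≤s i≤s) with i <ᵇ s in e | m≤n⇒m<n∨m≡n i≤s
  ... | true  | _        = inj₁ (<ᵇ⇒< i s (subst T (sym e) tt) , refl)
  ... | false | inj₁ i<s with () ← subst T e (<⇒<ᵇ i<s)
  ... | false | inj₂ i≡s = inj₂ (i≡s , refl)
  y′∈ : ∀ i → i < suc s → y′ i < suc n × T (p (y′ i))
  y′∈ i i< with view i i<
  ... | inj₁ (i<s , e) rewrite e = m<n⇒m<1+n (proj₁ (y∈ i i<s)) , proj₂ (y∈ i i<s)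
  ... | inj₂ (_   , e) rewrite e = ≤-refl , subst T (sym eq) tt
  inc′ : IncreasingBelow (suc s) y′
  inc′ {i} {i′} i<i′ i′< with view i (<-trans i<i′ i′<) | view i′ i′<
  ... | inj₁ (_   , e) | inj₁ (i′<s , e′) rewrite e | e′ = inc i<i′ i′<s
  ... | inj₁ (i<s , e) | inj₂ (_    , e′) rewrite e | e′ = proj₁ (y∈ i i<s)
  ... | inj₂ (refl , _) | _ = ⊥-elim (<⇒≱ i<i′ (s≤s⁻¹ i′<))

within-select : ∀ s p {a b} → T (within s p a b) →
  ∃ λ y → (∀ i → i < s → (a ≤ y i × y i < b) × T (p (y i))) × IncreasingBelow s y
within-select s p {a} {b} h with select s b (λ y → (a ≤ᵇ y) ∧ p y) (≤ᵇ⇒≤ s _ h)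
... | y , y∈ , inc = y , y∈′ , inc
  where
  y∈′ : ∀ i → i < s → (a ≤ y i × y i < b) × T (p (y i))
  y∈′ i i<s with y∈ i i<s
  ... | yi<b , t with Equivalence.to T-∧ t
  ...   | a≤yi , pyi = (≤ᵇ⇒≤ a (y i) a≤yi , yi<b) , pyi

module _ (j : ℕ) (1≤j : 1 ≤ j) (p : ℕ → Bool) where

  private
    tail : ℕ → ℕ
    tail n = count n (λ y → (cut (within j p) n ≤ᵇ y) ∧ p y)

    tail<j : ∀ n → tail n < j
    tail<j n with cut-or-false (within j p) n
    ... | inj₂ ¬w = ≰⇒> (λ j≤ → ¬w (≤⇒≤ᵇ j≤))
    ... | inj₁ eq = ≰⇒> none
      where
      none : ¬ j ≤ tail n
      none j≤ with within-select j p {cut (within j p) n} {n} (≤⇒≤ᵇ j≤)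
      ... | y , y∈ , _ with y∈ 0 1≤j
      ...   | (c≤y , y<n) , _ = <⇒≱ y<n (subst (_≤ y 0) eq c≤y)

    count≤ν+tail : ∀ n → count n p ≤ j * ν (within j p) n + tail n
    count≤ν+tail zero    = z≤n
    count≤ν+tail (suc n) with step (within j p) n
    ... | skip _ ceq neq rewrite ceq | neq = begin
      count n p + ⟦ p n ⟧                           ≤⟨ +-mono-≤ (count≤ν+tail n) (⟦⟧-mono (λ pn → Equivalence.from T-∧ (≤⇒≤ᵇ (cut≤ (within j p) n) , pn))) ⟩
      j * ν (within j p) n + tail n + ⟦ (cut (within j p) n ≤ᵇ n) ∧ p n ⟧ ≡⟨ +-assoc (j * ν (within j p) n) _ _ ⟩
      j * ν (within j p) n + (tail n + ⟦ (cut (within j p) n ≤ᵇ n) ∧ p n ⟧) ∎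
      where open ≤-Reasoning
    ... | fire _ _ neq rewrite neq = begin
      count n p + ⟦ p n ⟧                ≤⟨ +-mono-≤ (count≤ν+tail n) (⟦⟧≤1 (p n)) ⟩
      j * ν (within j p) n + tail n + 1  ≡⟨ trans (+-assoc (j * ν (within j p) n) _ 1) (cong (j * ν (within j p) n +_) (+-comm _ 1)) ⟩
      j * ν (within j p) n + suc (tail n) ≤⟨ +-monoʳ-≤ (j * ν (within j p) n) (tail<j n) ⟩
      j * ν (within j p) n + j           ≡⟨ trans (+-comm _ j) (sym (*-suc j _)) ⟩
      j * suc (ν (within j p) n)         ≤⟨ m≤m+n _ _ ⟩
      _                                  ∎
      where open ≤-Reasoning

  -- At most `j` ones are passed from one cut to the next, because the scan fires as soon as it has
  -- seen `j` of them; fewer than `j` follow the last cut.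
  count≤ν : ∀ n → count n p ≤ j * ν (within j p) n + j
  count≤ν n = ≤-trans (count≤ν+tail n) (+-monoʳ-≤ (j * ν (within j p) n) (<⇒≤ (tail<j n)))

+⟦⟧≤ : ∀ {x y} b → x ≤ y → (T b → x < y) → x + ⟦ b ⟧ ≤ y
+⟦⟧≤ {x} false x≤y _   = ≤-trans (≤-reflexive (+-identityʳ x)) x≤y
+⟦⟧≤ {x} true  _   x<y = ≤-trans (≤-reflexive (+-comm x 1)) (x<y tt)

-- Each one forms a good interval by itself, so the additive term of `count≤ν` disappears.
count≤ν-within-1 : ∀ p n → count n p ≤ ν (within 1 p) n
count≤ν-within-1 p zero    = z≤n
count≤ν-within-1 p (suc n) = begin
  count n p + ⟦ p n ⟧             ≤⟨ +-monoˡ-≤ ⟦ p n ⟧ (count≤ν-within-1 p n) ⟩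
  ν (within 1 p) n + ⟦ p n ⟧      ≤⟨ +⟦⟧≤ (p n) (ν-ascending (within 1 p) n)
                                       (λ pn → ν-grows {within 1 p} (within-monotone 1 p) {n} ≤-refl (here pn)) ⟩
  ν (within 1 p) (suc n)          ∎
  where
  open ≤-Reasoning
  here : T (p n) → T (within 1 p n (suc n))
  here pn = ≤⇒≤ᵇ (∃-count (λ y → (n ≤ᵇ y) ∧ p y) ≤-refl (Equivalence.from T-∧ (≤⇒≤ᵇ (≤-refl {n}) , pn)))

-- The only coordinate axis is reinterpreted as a line: a packing of `suc k` single ones gives
-- `suc k` cells, and the trivial line direction gets the one cell from 0 to 1.
bounded-1 : ∀ k N → Bounded (suc k) 1 1 N 1 k
bounded-1 k N .bound E mono ¬minor = begin
  ∑< N (λ c → ν (E (c ∷ [])) 1) ≡⟨ ∑<-cong N (λ c → ν-1 (E (c ∷ []))) ⟩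
  count N p                     ≤⟨ count≤ν-within-1 p N ⟩
  ν (within 1 p) N              ≤⟨ bound (bounded-line (suc k) k N N) (λ _ → within 1 p) (λ _ → within-monotone 1 p) ¬minor′ ⟩
  k                             ∎
  where
  open ≤-Reasoning
  p : ℕ → Bool
  p c = E (c ∷ []) 0 1
  ¬minor′ : ¬ Minor (suc k) (suc k) (λ (_ : Vec ℕ 0) → within 1 p)
  ¬minor′ (([] , θ) , hits) = ¬minor ((θ ∷ [] , consᵗ 0 (constant 1) z≤n) , hits′)
    where
    hits′ : Hits (suc k) 1 (θ ∷ [] , consᵗ 0 (constant 1) z≤n) (λ x a b → T (E x a b))
    hits′ (b ∷ []) zero with hits [] b
    ... | [] , _ , h with within-select 1 p {at θ (toℕ b)} {at θ (suc (toℕ b))} h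
    ...   | y , y∈ , _ with y∈ 0 ≤-refl
    ...     | y∈ , e = y 0 ∷ [] , (y∈ , tt) , e

-- Good intervals that cross block boundaries survive in the dilated family, bounded by `G`. The
-- blocks that contain a good interval are read as ones of a matrix with the block number as
-- additional axis, bounded by `P`.
bounded-dilate : ∀ k D N n t G P .{{_ : NonZero t}} → n ≤ N →
                 Bounded k k D N n G → Bounded k 1 (suc D) N 1 P →
                 Bounded k k D N (n * t) (t * P + 2 * G)
bounded-dilate k D N n t G P n≤N coarse flat .bound E mono ¬minor = begin
  ∑□ Ns (λ x → ν (E x) (n * t))
    ≤⟨ ∑□-mono Ns (λ x → ν-dilate t (E x) (mono x) n) ⟩
  ∑□ Ns (λ x → t * count n (λ p → chunk x p) + 2 * ν (dilate t (E x)) n)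
    ≡⟨ trans (∑□-+ Ns _ _) (cong₂ _+_ (∑□-*ˡ Ns t _) (∑□-*ˡ Ns 2 _)) ⟩
  t * ∑□ Ns (λ x → count n (λ p → chunk x p)) + 2 * ∑□ Ns (λ x → ν (dilate t (E x)) n)
    ≤⟨ +-mono-≤ (*-monoʳ-≤ t inner) (*-monoʳ-≤ 2 outer) ⟩
  t * P + 2 * G ∎
  where
  open ≤-Reasoning
  Ns : Vec ℕ D
  Ns = replicate D N

  chunk : Vec ℕ D → ℕ → Bool
  chunk x p = dilate t (E x) p (suc p)

  inFamily : Family (suc D)
  inFamily (p ∷ x) _ _ = chunk x p

  flags : Vec ℕ (suc D) → ℕ
  flags (p ∷ x) = ⟦ chunk x p ⟧

  inner : ∑□ Ns (λ x → count n (λ p → chunk x p)) ≤ P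
  inner = begin
    ∑□ Ns (λ x → count n (λ p → chunk x p))
      ≡⟨ ∑<-∑□-swap n Ns (λ p x → ⟦ chunk x p ⟧) ⟨
    ∑□ (n ∷ Ns) flags
      ≤⟨ ∑□-monoˡ {Ns = n ∷ Ns} flags (n≤N ∷ Pointwise.refl ≤-refl) ⟩
    ∑□ (replicate (suc D) N) flags
      ≤⟨ ∑□-mono (replicate (suc D) N) {flags} {λ x → ν (inFamily x) 1}
           (λ { (p ∷ x) → ≤-reflexive (sym (ν-1 (inFamily (p ∷ x)))) }) ⟩
    ∑□ (replicate (suc D) N) (λ x → ν (inFamily x) 1)
      ≤⟨ bound flat inFamily (λ { (p ∷ x) _ _ e → e }) ¬plain ⟩
    P ∎
    where
    ¬plain : ¬ Minor k 1 inFamily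
    ¬plain ((θ ∷ M , q) , hits) = ¬minor ((M , scaleᵗ t θ) , hits′)
      where
      hits′ : Hits k k (M , scaleᵗ t θ) (λ x a b → T (E x a b))
      hits′ β a with hits (a ∷ β) zero
      -- The block number `p` lies in cell `a`, so the whole block lies between the scaled
      -- thresholds of that cell, and monotonicity passes from the block to the cell.
      ... | p ∷ x , ((lo , hi) , x∈) , e = x , x∈ , mono x (*-monoˡ-≤ t lo) (*-monoˡ-≤ t hi) e

  outer : ∑□ Ns (λ x → ν (dilate t (E x)) n) ≤ G
  outer = bound coarse (λ x → dilate t (E x)) (λ x → dilate-monotone t (mono x))
    (λ { ((M , q) , hits) → ¬minor ((M , scaleᵗ t q) , hits) })

bounded-weaken : ∀ {k l D N n n′ F F′} → n ≤ n′ → F′ ≤ F → Bounded k l D N n′ F′ → Bounded k l D N n F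
bounded-weaken {D = D} {N} n≤n′ F′≤F b .bound E mono ¬minor =
  ≤-trans (∑□-mono (replicate D N) (λ x → ν-monoʳ (E x) n≤n′)) (≤-trans (bound b E mono ¬minor) F′≤F)

bounded-cast : ∀ {k l D N N′ n n′ F} → N ≡ N′ → n ≡ n′ → Bounded k l D N n F → Bounded k l D N′ n′ F
bounded-cast refl refl b = b

∑□-unit : ∀ D {f : Vec ℕ D → ℕ} → (∀ x → f x ≤ 1) → ∑□ (replicate D 1) f ≤ 1
∑□-unit zero    h = h []
∑□-unit (suc D) h = ∑□-unit D (λ x → h (0 ∷ x))

bounded-unit : ∀ {k l D F} → 1 ≤ F → Bounded k l D 1 1 F
bounded-unit {D = D} 1≤F .bound E _ _ =
  ≤-trans (∑□-unit D (λ x → subst (_≤ 1) (sym (ν-1 (E x))) (⟦⟧≤1 (E x 0 1)))) 1≤F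

-- Choice of constants, induction on side length and dimension

n<2^n : ∀ n → n < 2 ^ n
n<2^n zero    = s≤s z≤n
n<2^n (suc n) = +-mono-≤ (m^n>0 2 n) (≤-trans (n<2^n n) (m≤m+n _ 0))

^-distribʳ-* : ∀ e m n → (m * n) ^ e ≡ m ^ e * n ^ e
^-distribʳ-* zero    m n = refl
^-distribʳ-* (suc e) m n = trans (cong (m * n *_) (^-distribʳ-* e m n)) ([m*n]*[o*p]≡[m*o]*[n*p] m n (m ^ e) (n ^ e))

-- Exponents of `T₀` that dominate the factors of the loss which do not grow with `e`: the number
-- `D` of axes, `s ^ D`, `t`, `t * t`, the facet constant `T₀ ^ α`, and one factor `t ^ g` split off
-- from the facet bound.
lossExp : ℕ → ℕ → ℕ → ℕ
lossExp D g α = D + (D + (2 + (4 + (α + (g + g)))))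

-- Here the grid has 1 + k cells per direction. A contraction costs a factor s ^ D, and
-- t = (2 s)² makes this smaller than t ^ (D - 1) as soon as D ≥ 2.
module Constants (k : ℕ) where

  s T₀ t : ℕ
  s  = 2 ^ k
  T₀ = 2 ^ suc k
  t  = 2 ^ (suc k + suc k)

  instance
    T₀≢0 : NonZero T₀
    T₀≢0 = m^n≢0 2 (suc k)
    t≢0 : NonZero t
    t≢0 = m^n≢0 2 (suc k + suc k)

  s≤T : s ≤ T₀
  s≤T = ^-monoʳ-≤ 2 (n≤1+n k)

  s<T : s < T₀
  s<T = ^-monoʳ-< 2 ≤-refl (n<1+n k)

  2≤T : 2 ≤ T₀
  2≤T = *-monoʳ-≤ 2 {1} {s} (m^n>0 2 k)

  t≡T² : t ≡ T₀ * T₀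
  t≡T² = ^-distribˡ-+-* 2 (suc k) (suc k)

  t^ : ∀ g → t ^ g ≡ T₀ ^ (g + g)
  t^ g = trans (cong (_^ g) t≡T²) (trans (^-distribʳ-* g T₀ T₀) (sym (^-distribˡ-+-* T₀ g g)))

  m≤T^m : ∀ m → m ≤ T₀ ^ m
  m≤T^m m = ≤-trans (<⇒≤ (n<2^n m)) (^-monoˡ-≤ m 2≤T)

  1≤T^ : ∀ m → 1 ≤ T₀ ^ m
  1≤T^ m = m^n>0 T₀ m

  T^≤t^ : ∀ D → T₀ ^ (2 + D) ≤ t ^ suc D
  T^≤t^ D = begin
    T₀ ^ (2 + D)           ≤⟨ ^-monoʳ-≤ T₀ (s≤s (≤-trans (≤-reflexive (+-comm 1 D)) (+-monoʳ-≤ D (s≤s z≤n)))) ⟩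
    T₀ ^ (suc D + suc D)   ≡⟨ t^ (suc D) ⟨
    t ^ suc D              ∎
    where open ≤-Reasoning

  loss-bound : ∀ D g α e →
    D * (s ^ D * (t * (t ^ e * ((t * t) * (T₀ ^ α * (t ^ g) ^ suc e))))) ≤
    T₀ ^ lossExp D g α * (t ^ suc g) ^ e
  loss-bound D g α e = begin
    D * (s ^ D * (t * (t ^ e * ((t * t) * (T₀ ^ α * (t ^ g * (t ^ g) ^ e))))))
      ≡⟨ solve 7 (λ D S t te Ta tg tge →
           D :* (S :* (t :* (te :* ((t :* t) :* (Ta :* (tg :* tge)))))) :=
           (D :* (S :* (t :* ((t :* t) :* (Ta :* tg))))) :* (te :* tge)) refl
           D (s ^ D) t (t ^ e) (T₀ ^ α) (t ^ g) ((t ^ g) ^ e) ⟩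
    D * (s ^ D * (t * ((t * t) * (T₀ ^ α * t ^ g)))) * (t ^ e * (t ^ g) ^ e)
      ≤⟨ *-mono-≤ const (≤-reflexive (sym (^-distribʳ-* e t (t ^ g)))) ⟩
    T₀ ^ lossExp D g α * (t ^ suc g) ^ e ∎
    where
    open ≤-Reasoning
    open +-*-Solver
    t≡ : t ≡ T₀ ^ 2
    t≡ = trans t≡T² (cong (T₀ *_) (sym (*-identityʳ T₀)))
    const : D * (s ^ D * (t * ((t * t) * (T₀ ^ α * t ^ g)))) ≤ T₀ ^ lossExp D g α
    const = begin
      D * (s ^ D * (t * ((t * t) * (T₀ ^ α * t ^ g))))
        ≤⟨ *-mono-≤ (m≤T^m D) (*-mono-≤ (^-monoˡ-≤ D s≤T) (*-mono-≤ (≤-reflexive t≡)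
             (*-mono-≤ (≤-reflexive (trans (cong₂ _*_ t≡ t≡) (sym (^-distribˡ-+-* T₀ 2 2)))) (*-monoʳ-≤ (T₀ ^ α) (≤-reflexive (t^ g)))))) ⟩
      T₀ ^ D * (T₀ ^ D * (T₀ ^ 2 * (T₀ ^ 4 * (T₀ ^ α * T₀ ^ (g + g)))))
        ≡⟨ pow D (D + (2 + (4 + (α + (g + g))))) (pow D (2 + (4 + (α + (g + g)))) (pow 2 (4 + (α + (g + g))) (pow 4 (α + (g + g)) (pow α (g + g) refl)))) ⟩
      T₀ ^ lossExp D g α ∎
      where
      pow : ∀ m n {x} → x ≡ T₀ ^ n → T₀ ^ m * x ≡ T₀ ^ (m + n)
      pow m n refl = sym (^-distribˡ-+-* T₀ m n)

  -- The contraction factor `a` is strictly below the growth `τ` of the bound, which leaves room for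
  -- one more `b * τ ^ e`, the loss.
  recurrence : ∀ a b τ e → a < τ → a * (b * τ ^ e) + b * τ ^ e ≤ b * τ ^ suc e
  recurrence a b τ e a<τ = begin
    a * (b * τ ^ e) + b * τ ^ e ≡⟨ +-comm (a * (b * τ ^ e)) _ ⟩
    suc a * (b * τ ^ e)         ≤⟨ *-monoˡ-≤ (b * τ ^ e) a<τ ⟩
    τ * (b * τ ^ e)             ≡⟨ solve 3 (λ τ b p → τ :* (b :* p) := b :* (τ :* p)) refl τ b (τ ^ e) ⟩
    b * τ ^ suc e               ∎
    where
    open ≤-Reasoning
    open +-*-Solver

k≤2^1+k : ∀ k e → k ≤ (2 ^ suc k) ^ 1 * 1 ^ e
k≤2^1+k k e = begin
  k                        ≤⟨ <⇒≤ (n<2^n k) ⟩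
  2 ^ k                    ≤⟨ ^-monoʳ-≤ 2 (n≤1+n k) ⟩
  2 ^ suc k                ≡⟨ ^-identityʳ (2 ^ suc k) ⟨
  (2 ^ suc k) ^ 1          ≡⟨ *-identityʳ _ ⟨
  (2 ^ suc k) ^ 1 * 1      ≡⟨ cong ((2 ^ suc k) ^ 1 *_) (^-zeroˡ e) ⟨
  (2 ^ suc k) ^ 1 * 1 ^ e  ∎
  where open ≤-Reasoning

side : ℕ → ℕ → ℕ
side k e = Constants.t k ^ e

-- On lines of length 1 a family is a zero-one matrix with entries E x 0 1, and ν is the entry.
plain : ∀ D → ∃ λ α → ∀ k e →
        Bounded (suc k) 1 (suc D) (side k e) 1 ((2 ^ suc k) ^ α * (side k D) ^ e)
plain zero = 1 , λ k e → bounded-weaken {suc k} {1} {1} ≤-refl (k≤2^1+k k e) (bounded-1 k (side k e))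
plain (suc D) with plain D
... | α , facet = β , go
  where
  β : ℕ
  -- All `2 + D` axes are contracted, while the bound for facets of dimension `suc D` grows like
  -- `(t ^ D) ^ e`.
  β = lossExp (2 + D) D α
  go : ∀ k e → Bounded (suc k) 1 (2 + D) (side k e) 1 ((2 ^ suc k) ^ β * (side k (suc D)) ^ e)
  go k zero    = bounded-unit (subst (1 ≤_) (sym (*-identityʳ _)) (Constants.1≤T^ k β))
  go k (suc e) = bounded-cast (*-comm (t ^ e) t) refl
    (bounded-weaken {suc k} {1} {2 + D} ≤-refl
      (≤-trans (+-monoʳ-≤ _ (loss-bound (2 + D) D α e)) (recurrence (s ^ (2 + D)) (T₀ ^ β) (t ^ suc D) e (≤-trans (^-monoˡ-< (2 + D) s<T) (T^≤t^ D))))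
      (contract {r = suc k + suc k}
        (bounded-cast (*-comm t (t ^ e)) refl (facet k (suc e))) (go k e)))
    where open Constants k

-- The bound is a constant times the number of lines in the box. In the step from `t ^ e` to
-- `t ^ suc e`, the lines are first shortened by `bounded-dilate`, which doubles the main term and
-- leaves the intervals inside blocks to `plain`; then all coordinate axes are contracted, with
-- facets one dimension lower.
items : ∀ D → ∃ λ α → ∀ k e →
        Bounded (suc k) (suc k) D (side k e) (side k e) ((2 ^ suc k) ^ α * (side k D) ^ e)
items zero = 1 , λ k e → bounded-weaken {suc k} {suc k} {0} ≤-refl (k≤2^1+k k e) (bounded-line (suc k) k (side k e) (side k e))
items (suc D) with items D | plain (suc D)
... | α , facet | αₚ , plainᵇ = γ , go
  where
  β δ γ : ℕ
  β = lossExp (suc D) D α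
  -- Exponent for the contribution of `plain`: the factor `t`, its constant, and one factor `τ`
  -- taken out of `τ ^ suc e`.
  δ = 2 + (αₚ + (suc D + suc D))
  -- The added 2 absorbs the sum of three terms, since `3 ≤ T₀ * T₀`.
  γ = 2 + (β + δ)
  go : ∀ k e → Bounded (suc k) (suc k) (suc D) (side k e) (side k e) ((2 ^ suc k) ^ γ * (side k (suc D)) ^ e)
  go k zero    = bounded-unit (subst (1 ≤_) (sym (*-identityʳ _)) (Constants.1≤T^ k γ))
  go k (suc e) = bounded-cast (*-comm (t ^ e) t) (*-comm (t ^ e) t)
    (bounded-weaken {suc k} {suc k} {suc D} ≤-refl total
      (bounded-dilate (suc k) (suc D) (t ^ e * t) (t ^ e) t _ _ t^e≤
        (contract {r = suc k + suc k}
          -- After the dilation the lines have length `t ^ e`, whereas the facets still have side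
          -- `t ^ suc e`.
          (bounded-weaken {suc k} {suc k} {D} t^e≤ ≤-refl
            (bounded-cast (*-comm t (t ^ e)) (*-comm t (t ^ e)) (facet k (suc e))))
          (go k e))
        (bounded-cast (*-comm t (t ^ e)) refl (plainᵇ k (suc e)))))
    where
    open Constants k
    open ≤-Reasoning
    open +-*-Solver
    t^e≤ : t ^ e ≤ t ^ e * t
    t^e≤ = m≤m*n (t ^ e) t
    τ : ℕ
    τ = t ^ suc D
    tP : t * (T₀ ^ αₚ * τ ^ suc e) ≡ T₀ ^ δ * τ ^ e
    tP = trans (solve 4 (λ t P τ τe → t :* (P :* (τ :* τe)) := (t :* (P :* τ)) :* τe) refl t (T₀ ^ αₚ) τ (τ ^ e))
      (cong (_* τ ^ e) (trans (cong₂ _*_ (trans t≡T² (cong (T₀ *_) (sym (*-identityʳ T₀))))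
          (trans (cong (T₀ ^ αₚ *_) (t^ (suc D))) (sym (^-distribˡ-+-* T₀ αₚ (suc D + suc D)))))
        (sym (^-distribˡ-+-* T₀ 2 (αₚ + (suc D + suc D))))))
    exps : T₀ ^ δ + 2 * T₀ ^ β ≤ T₀ ^ γ
    exps = begin
      T₀ ^ δ + 2 * T₀ ^ β
        ≤⟨ +-mono-≤ (^-monoʳ-≤ T₀ (m≤n+m δ β)) (*-monoʳ-≤ 2 (^-monoʳ-≤ T₀ (m≤m+n β δ))) ⟩
      3 * T₀ ^ (β + δ)     ≤⟨ *-monoˡ-≤ (T₀ ^ (β + δ)) (≤-trans (n≤1+n 3) (*-mono-≤ 2≤T 2≤T)) ⟩
      T₀ * T₀ * T₀ ^ (β + δ) ≡⟨ *-assoc T₀ T₀ _ ⟩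
      T₀ ^ γ               ∎
    a<τ : 2 * s ^ suc D < τ
    a<τ = begin-strict
      2 * s ^ suc D   <⟨ *-monoʳ-< 2 (^-monoˡ-< (suc D) s<T) ⟩
      2 * T₀ ^ suc D  ≤⟨ *-monoˡ-≤ (T₀ ^ suc D) 2≤T ⟩
      T₀ ^ (2 + D)    ≤⟨ T^≤t^ D ⟩
      τ               ∎
    X L : ℕ
    X = T₀ ^ γ * τ ^ e
    L = suc D * (s ^ suc D * (t * (t ^ e * ((t * t) * (T₀ ^ α * (t ^ D) ^ suc e)))))
    total : t * (T₀ ^ αₚ * τ ^ suc e) + 2 * (s ^ suc D * X + L) ≤ T₀ ^ γ * τ ^ suc e
    total = begin
      t * (T₀ ^ αₚ * τ ^ suc e) + 2 * (s ^ suc D * X + L)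
        ≤⟨ +-mono-≤ (≤-reflexive tP) (*-monoʳ-≤ 2 (+-monoʳ-≤ (s ^ suc D * X) (loss-bound (suc D) D α e))) ⟩
      T₀ ^ δ * τ ^ e + 2 * (s ^ suc D * X + T₀ ^ β * τ ^ e)
        ≡⟨ solve 5 (λ d p s X b → d :* p :+ con 2 :* (s :* X :+ b :* p) := con 2 :* s :* X :+ (d :+ con 2 :* b) :* p)
             refl (T₀ ^ δ) (τ ^ e) (s ^ suc D) X (T₀ ^ β) ⟩
      2 * s ^ suc D * X + (T₀ ^ δ + 2 * T₀ ^ β) * τ ^ e
        ≤⟨ +-monoʳ-≤ (2 * s ^ suc D * X) (*-monoˡ-≤ (τ ^ e) exps) ⟩
      2 * s ^ suc D * X + X
        ≤⟨ recurrence (2 * s ^ suc D) (T₀ ^ γ) τ e a<τ ⟩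
      T₀ ^ γ * τ ^ suc e ∎

-- From grids to submatrices

-- The entry of M at x, extended by 0 outside of M.
bit : ∀ {d} (ns : Vec ℕ d) → Matrix ns → Vec ℕ d → Bool
bit []       M []      = M
bit (n ∷ ns) M (c ∷ x) with c <? n
... | yes c<n = bit ns (lookup M (fromℕ< c<n)) x
... | no  _   = false

bit-∷ : ∀ {d n} (ns : Vec ℕ d) (M : Matrix (n ∷ ns)) i x → bit (n ∷ ns) M (toℕ i ∷ x) ≡ bit ns (lookup M i) x
bit-∷ {n = n} ns M i x with toℕ i <? n
... | yes i<n = cong (λ i → bit ns (lookup M i) x) (fromℕ<-toℕ i i<n)
... | no  i≮n = ⊥-elim (i≮n (toℕ<n i))

bit-bounded : ∀ {d} (ns : Vec ℕ d) M x → T (bit ns M x) → ∀ m → lookup x m < lookup ns m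
bit-bounded (n ∷ ns) M (c ∷ x) t m with c <? n
bit-bounded (n ∷ ns) M (c ∷ x) t zero    | yes c<n = c<n
bit-bounded (n ∷ ns) M (c ∷ x) t (suc m) | yes c<n = bit-bounded ns _ x t m

bit-sound : ∀ {d} (ns : Vec ℕ d) M (i : Index ns) x →
            (∀ m → toℕ (coordinate {ns = ns} m i) ≡ lookup x m) → T (bit ns M x) → _!_ {ns = ns} M i ≡ true
bit-sound []       M []       []      h t = Equivalence.to T-≡ t
bit-sound (n ∷ ns) M (i ∷ is) (c ∷ x) h t with refl ← h zero =
  bit-sound ns (lookup M i) is x (h ∘ suc) (subst T (bit-∷ ns M i x) t)

sum-map : ∀ {A : Set} {n} (v : Vec A n) (g : A → ℕ) (h : ℕ → ℕ) →
          (∀ i → h (toℕ i) ≡ g (lookup v i)) → Vec.sum (Vec.map g v) ≡ ∑< n h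
sum-map []      g h eq = refl
sum-map {n = suc n} (x ∷ v) g h eq =
  trans (cong₂ _+_ (sym (eq zero)) (sum-map v g (h ∘ suc) (eq ∘ suc))) (sym (∑<-split 1 n h))

ones≡∑□ : ∀ {d} (ns : Vec ℕ d) M → ones ns M ≡ ∑□ ns (λ x → ⟦ bit ns M x ⟧)
ones≡∑□ []       true  = refl
ones≡∑□ []       false = refl
ones≡∑□ (n ∷ ns) M     = sum-map M (ones ns) _ λ i →
  trans (∑□-cong ns (λ x → cong ⟦_⟧ (bit-∷ ns M i x))) (sym (ones≡∑□ ns (lookup M i)))
  where
  ∑□-cong : ∀ {D} (Ns : Vec ℕ D) {f g : Vec ℕ D → ℕ} → (∀ x → f x ≡ g x) → ∑□ Ns f ≡ ∑□ Ns g
  ∑□-cong Ns eq = ≤-antisym (∑□-mono Ns (≤-reflexive ∘ eq)) (∑□-mono Ns (≤-reflexive ∘ sym ∘ eq))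

-- A coordinate of the Kronecker product is a pair of a block number and a position inside the
-- block; the two conditions say that the chosen positions increase lexicographically.
record Axis (k r n : ℕ) : Set where
  field
    pos       : Fin k → Fin r → Fin n
    inc-outer : ∀ {a a′} b b′ → a Fin.< a′ → pos a b Fin.< pos a′ b′
    inc-inner : ∀ a {b b′} → b Fin.< b′ → pos a b Fin.< pos a b′

open Axis

Axes : ∀ {d} → Vec ℕ d → Vec ℕ d → Vec ℕ d → Set
Axes ks rs ns = ∀ m → Axis (lookup ks m) (lookup rs m) (lookup ns m)

outer : ∀ {d} (ks rs : Vec ℕ d) → Index (zipWith _*_ ks rs) → Index ks
outer []       []       []       = []
outer (k ∷ ks) (r ∷ rs) (i ∷ is) = quotient r i ∷ outer ks rs is

inner : ∀ {d} (ks rs : Vec ℕ d) → Index (zipWith _*_ ks rs) → Index rs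
inner []       []       []       = []
inner (k ∷ ks) (r ∷ rs) (i ∷ is) = remainder {k} r i ∷ inner ks rs is

⊗-outer : ∀ {d} (ks rs : Vec ℕ d) M N i →
          _!_ {ns = zipWith _*_ ks rs} (_⊗_ {ms = ks} {ns = rs} M N) i ≡ true →
          _!_ {ns = ks} M (outer ks rs i) ≡ true
⊗-outer []       []       true M [] _ = refl
⊗-outer (k ∷ ks) (r ∷ rs) M    N (i ∷ is) h =
  ⊗-outer ks rs (lookup M a) (lookup N b) is (trans (cong (λ B → _!_ {ns = zipWith _*_ ks rs} B is) (sym block)) h)
  where
  a : Fin k
  a = quotient r i
  b : Fin r
  b = remainder {k} r i
  block : lookup (_⊗_ {ms = k ∷ ks} {ns = r ∷ rs} M N) i ≡ _⊗_ {ms = ks} {ns = rs} (lookup M a) (lookup N b)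
  block = trans (cong (lookup (_⊗_ {ms = k ∷ ks} {ns = r ∷ rs} M N)) (sym (Fin.combine-remQuot {k} r i)))
    (trans (lookup-concat (Vec.map _ M) a b)
      (trans (cong (λ v → lookup v b) (lookup-map a _ M)) (lookup-map b _ N)))

place : ∀ {d} (ks rs ns : Vec ℕ d) → Axes ks rs ns → Index ks → Index rs → Index ns
place []       []       []       ax []       []       = []
place (k ∷ ks) (r ∷ rs) (n ∷ ns) ax (a ∷ as) (b ∷ bs) = pos (ax zero) a b ∷ place ks rs ns (ax ∘ suc) as bs

coordinate-place : ∀ {d} (ks rs ns : Vec ℕ d) (ax : Axes ks rs ns) as bs m →
  coordinate {ns = ns} m (place ks rs ns ax as bs) ≡ pos (ax m) (coordinate {ns = ks} m as) (coordinate {ns = rs} m bs)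
coordinate-place (k ∷ ks) (r ∷ rs) (n ∷ ns) ax (a ∷ as) (b ∷ bs) zero    = refl
coordinate-place (k ∷ ks) (r ∷ rs) (n ∷ ns) ax (a ∷ as) (b ∷ bs) (suc m) =
  coordinate-place ks rs ns (ax ∘ suc) as bs m

selection : ∀ {d} (ks rs ns : Vec ℕ d) → Axes ks rs ns → Selection (zipWith _*_ ks rs) ns
selection []       []       []       ax = []
selection (k ∷ ks) (r ∷ rs) (n ∷ ns) ax =
  tabulate (λ i → pos (ax zero) (quotient r i) (remainder {k} r i)) ∷ selection ks rs ns (ax ∘ suc)

selection-increasing : ∀ {d} (ks rs ns : Vec ℕ d) (ax : Axes ks rs ns) → Increasing (selection ks rs ns ax)
selection-increasing []       []       []       ax = tt
selection-increasing (k ∷ ks) (r ∷ rs) (n ∷ ns) ax = inc , selection-increasing ks rs ns (ax ∘ suc)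
  where
  inc : ∀ {i i′} → i Fin.< i′ →
        lookup (tabulate (λ i → pos (ax zero) (quotient r i) (remainder {k} r i))) i Fin.<
        lookup (tabulate (λ i → pos (ax zero) (quotient r i) (remainder {k} r i))) i′
  inc {i} {i′} i<i′
    rewrite lookup∘tabulate (λ i → pos (ax zero) (quotient r i) (remainder {k} r i)) i
          | lookup∘tabulate (λ i → pos (ax zero) (quotient r i) (remainder {k} r i)) i′
    with Fin.<-cmp (quotient {k} r i) (quotient r i′)
  ... | tri< a<a′ _ _ = inc-outer (ax zero) _ _ a<a′
  ... | tri> _ _ a′<a = ⊥-elim (<-asym i<i′ (subst₂ Fin._<_ (Fin.combine-remQuot {k} r i′) (Fin.combine-remQuot {k} r i)
                          (Fin.combine-monoˡ-< (remainder {k} r i′) (remainder {k} r i) a′<a)))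
  ... | tri≈ _ a≡a′ _ rewrite sym a≡a′ = inc-inner (ax zero) (quotient r i) (+-cancelˡ-< (r * toℕ (quotient r i)) _ _
      (subst₂ _<_ (trans (cong toℕ (sym (Fin.combine-remQuot {k} r i))) (Fin.toℕ-combine (quotient r i) (remainder {k} r i)))
                  (trans (cong toℕ (sym (Fin.combine-remQuot {k} r i′))) (trans (Fin.toℕ-combine (quotient r i′) (remainder {k} r i′))
                     (cong (λ q → r * toℕ q + toℕ (remainder {k} r i′)) (sym a≡a′))))
                  i<i′))

submatrix-selection : ∀ {d} (ks rs ns : Vec ℕ d) (ax : Axes ks rs ns) M i →
  _!_ {ns = zipWith _*_ ks rs} (submatrix (selection ks rs ns ax) M) i ≡
  _!_ {ns = ns} M (place ks rs ns ax (outer ks rs i) (inner ks rs i))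
submatrix-selection []       []       []       ax M []       = refl
submatrix-selection (k ∷ ks) (r ∷ rs) (n ∷ ns) ax M (i ∷ is) =
  trans (cong (λ N → _!_ {ns = zipWith _*_ ks rs} N is)
          (trans (lookup-map i _ (tabulate p)) (cong (λ c → submatrix (selection ks rs ns (ax ∘ suc)) (lookup M c)) (lookup∘tabulate p i))))
    (submatrix-selection ks rs ns (ax ∘ suc) (lookup M (p i)) is)
  where
  p : Fin (k * r) → Fin n
  p i = pos (ax zero) (quotient r i) (remainder {k} r i)

toVec : ∀ {K} d → Index (cube d K) → Vec (Fin K) d
toVec zero    []       = []
toVec (suc d) (i ∷ is) = i ∷ toVec d is

toVec-coordinate : ∀ {K} d (i : Index (cube d K)) m → toℕ (lookup (toVec d i) m) ≡ toℕ (coordinate {ns = cube d K} m i)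
toVec-coordinate (suc d) (i ∷ is) zero    = refl
toVec-coordinate (suc d) (i ∷ is) (suc m) = toVec-coordinate d is m

InBox-lookup : ∀ {D k} (Θ : Vec Thresholds D) (β : Vec (Fin k) D) x → InBox Θ β x → ∀ m →
               at (lookup Θ m) (toℕ (lookup β m)) ≤ lookup x m × lookup x m < at (lookup Θ m) (suc (toℕ (lookup β m)))
InBox-lookup (_ ∷ Θ) (_ ∷ β) (_ ∷ x) (c∈ , _)  zero    = c∈
InBox-lookup (_ ∷ Θ) (_ ∷ β) (_ ∷ x) (_ , x∈) (suc m) = InBox-lookup Θ β x x∈ m

insertAt-≢ : ∀ {A : Set} {n} (xs : Vec A n) {i j} (v w : A) → i ≢ j → lookup (insertAt xs i v) j ≡ lookup (insertAt xs i w) j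
insertAt-≢ xs {i} v w i≢j rewrite sym (Fin.punchIn-punchOut i≢j) =
  trans (insertAt-punchIn xs i v _) (sym (insertAt-punchIn xs i w _))

fibreFamily : ∀ {D n} (j : ℕ) (ℓ : Fin (suc D)) → Matrix (cube (suc D) n) → Family D
fibreFamily {D} {n} j ℓ M x = within j (λ c → bit (cube (suc D) n) M (insertAt x ℓ c))

module _ {D n K : ℕ} (j : ℕ) (1≤j : 1 ≤ j) (ℓ : Fin (suc D)) (P : Matrix (cube (suc D) K))
         (perm : IsPermutation (suc D) K P) (M : Matrix (cube (suc D) n)) where

  private
    d : ℕ
    d = suc D

    rs : Vec ℕ d
    rs = replicate d 1 [ ℓ ]≔ j

    module FromMinor (Θ : Vec Thresholds D) (θ : Thresholds)
      (hits : Hits K K (Θ , θ) (λ x a b → T (fibreFamily {D} {n} j ℓ M x a b))) where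

      hit : (i : Vec (Fin K) d) → ∃ λ x → InBox Θ (removeAt i ℓ) x × _
      hit i = hits (removeAt i ℓ) (lookup i ℓ)

      heights : (i : Vec (Fin K) d) → _
      heights i = within-select j (λ c → bit (cube d n) M (insertAt (proj₁ (hit i)) ℓ c))
                    {at θ (toℕ (lookup i ℓ))} {at θ (suc (toℕ (lookup i ℓ)))} (proj₂ (proj₂ (hit i)))

      point : Vec (Fin K) d → ℕ → Vec ℕ d
      point i b = insertAt (proj₁ (hit i)) ℓ (proj₁ (heights i) b)

      point-bit : ∀ i {b} → b < j → T (bit (cube d n) M (point i b))
      point-bit i b<j = proj₂ (proj₁ (proj₂ (heights i)) _ b<j)

      point-box : ∀ i {b} → b < j → InBox (insertAt Θ ℓ θ) i (point i b)
      point-box i b<j with proj₁ (proj₁ (proj₂ (heights i)) _ b<j)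
      ... | lo , hi = InBox-insertAt Θ i (proj₁ (hit i)) ℓ θ _ lo hi (proj₁ (proj₂ (hit i)))

      point-inc : ∀ i {b b′} → b < b′ → b′ < j → lookup (point i b) ℓ < lookup (point i b′) ℓ
      point-inc i {b} {b′} b<b′ b′<j =
        subst₂ _<_ (sym (insertAt-lookup (proj₁ (hit i)) ℓ (y b))) (sym (insertAt-lookup (proj₁ (hit i)) ℓ (y b′)))
          (proj₂ (proj₂ (heights i)) b<b′ b′<j)
        where
        y : ℕ → ℕ
        y = proj₁ (heights i)

      point-≢ : ∀ i b b′ m → ℓ ≢ m → lookup (point i b) m ≡ lookup (point i b′) m
      point-≢ i b b′ m ℓ≢m = insertAt-≢ (proj₁ (hit i)) _ _ ℓ≢m

      rs-≢ : ∀ m → ℓ ≢ m → lookup rs m ≡ 1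
      rs-≢ m ℓ≢m = trans (lookup∘update′ (ℓ≢m ∘ sym) (replicate d 1) j) (lookup-replicate m 1)

      rs≤j : ∀ m → lookup rs m ≤ j
      rs≤j m with ℓ Fin.≟ m
      ... | yes refl = ≤-reflexive (lookup∘update ℓ (replicate d 1) j)
      ... | no  ℓ≢m  = ≤-trans (≤-reflexive (rs-≢ m ℓ≢m)) 1≤j

      inner<j : ∀ m (b : Fin (lookup rs m)) → toℕ b < j
      inner<j m b = ≤-trans (toℕ<n b) (rs≤j m)

      -- The cell of the one of `P` that has coordinate `a` on axis `m`; the points found in this
      -- cell determine which positions are selected for `a` on that axis.
      one : ∀ m → Fin (lookup (cube d K) m) → Vec (Fin K) d
      one m a = toVec d (proj₁ (perm m a))

      one-coordinate : ∀ m a → toℕ (lookup (one m a) m) ≡ toℕ a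
      one-coordinate m a = trans (toVec-coordinate d (proj₁ (perm m a)) m) (cong toℕ (proj₁ (proj₁ (proj₂ (perm m a)))))

      -- Distinct values of `a` refer to distinct cells of axis `m`, which the thresholds separate.
      -- Inside one cell only axis `ℓ` offers several positions, namely the increasing ones of a
      -- good interval.
      axes : Axes (cube d K) rs (cube d n)
      axes m = record
        { pos       = p
        ; inc-outer = λ {a} {a′} b b′ a<a′ → subst₂ _<_ (sym (toℕ-p a b)) (sym (toℕ-p a′ b′)) (apart b b′ a<a′)
        ; inc-inner = λ a {b} {b′} b<b′ → subst₂ _<_ (sym (toℕ-p a b)) (sym (toℕ-p a b′)) (grows a b<b′)
        }
        where
        p : Fin (lookup (cube d K) m) → Fin (lookup rs m) → Fin (lookup (cube d n) m)
        p a b = fromℕ< (bit-bounded (cube d n) M (point (one m a) (toℕ b)) (point-bit (one m a) (inner<j m b)) m)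
        toℕ-p : ∀ a b → toℕ (p a b) ≡ lookup (point (one m a) (toℕ b)) m
        toℕ-p a b = toℕ-fromℕ< _
        box : ∀ a b → at (lookup (insertAt Θ ℓ θ) m) (toℕ a) ≤ lookup (point (one m a) (toℕ b)) m ×
                      lookup (point (one m a) (toℕ b)) m < at (lookup (insertAt Θ ℓ θ) m) (suc (toℕ a))
        box a b = subst (λ c → at (lookup (insertAt Θ ℓ θ) m) c ≤ lookup (point (one m a) (toℕ b)) m ×
                               lookup (point (one m a) (toℕ b)) m < at (lookup (insertAt Θ ℓ θ) m) (suc c))
          (one-coordinate m a) (InBox-lookup (insertAt Θ ℓ θ) (one m a) _ (point-box (one m a) (inner<j m b)) m)
        apart : ∀ {a a′} b b′ → a Fin.< a′ → lookup (point (one m a) (toℕ b)) m < lookup (point (one m a′) (toℕ b′)) m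
        apart {a} {a′} b b′ a<a′ =
          ≤-trans (proj₂ (box a b)) (≤-trans (at-mono (lookup (insertAt Θ ℓ θ) m) a<a′) (proj₁ (box a′ b′)))
        grows : ∀ a {b b′} → b Fin.< b′ → lookup (point (one m a) (toℕ b)) m < lookup (point (one m a) (toℕ b′)) m
        grows a {b} {b′} b<b′ with ℓ Fin.≟ m
        ... | yes refl = point-inc (one m a) b<b′ (inner<j m b′)
        ... | no  ℓ≢m  = ⊥-elim (<⇒≱ (toℕ<n b′) (≤-trans (≤-reflexive (rs-≢ m ℓ≢m)) (≤-trans (s≤s z≤n) b<b′)))

      contains : Contains {ms = zipWith _*_ (cube d K) rs} {ns = cube d n} M (_⊗_ {ms = cube d K} {ns = rs} P (R rs))
      contains = selection (cube d K) rs (cube d n) axes , selection-increasing (cube d K) rs (cube d n) axes , covers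
        where
        covers : ∀ i → _!_ {ns = zipWith _*_ (cube d K) rs} (_⊗_ {ms = cube d K} {ns = rs} P (R rs)) i ≡ true →
                 _!_ {ns = zipWith _*_ (cube d K) rs} (submatrix (selection (cube d K) rs (cube d n) axes) M) i ≡ true
        covers i h = trans (submatrix-selection (cube d K) rs (cube d n) axes M i)
          (bit-sound (cube d n) M (place (cube d K) rs (cube d n) axes i′ i″) (point (toVec d i′) b) coords
            (point-bit (toVec d i′) (inner<j ℓ (coordinate {ns = rs} ℓ i″))))
          where
          i′ : Index (cube d K)
          i′ = outer (cube d K) rs i
          i″ : Index rs
          i″ = inner (cube d K) rs i
          b : ℕ
          b = toℕ (coordinate {ns = rs} ℓ i″)
          -- A one of the pattern lies over a one `i′` of `P`. By uniqueness in each cross section,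
          -- all axes consult the cell of `i′`, so the selected coordinates belong to one and the
          -- same point of `M`.
          one≡ : ∀ m → one m (coordinate {ns = cube d K} m i′) ≡ toVec d i′
          one≡ m = cong (toVec d) (proj₂ (proj₂ (perm m (coordinate {ns = cube d K} m i′))) (refl , ⊗-outer (cube d K) rs P (R rs) i h))
          same : ∀ m → lookup (point (toVec d i′) (toℕ (coordinate {ns = rs} m i″))) m ≡ lookup (point (toVec d i′) b) m
          same m with ℓ Fin.≟ m
          ... | yes refl = refl
          ... | no  ℓ≢m  = point-≢ (toVec d i′) _ _ m ℓ≢m
          coords : ∀ m → toℕ (coordinate {ns = cube d n} m (place (cube d K) rs (cube d n) axes i′ i″)) ≡
                         lookup (point (toVec d i′) b) m
          coords m = trans (cong toℕ (coordinate-place (cube d K) rs (cube d n) axes i′ i″ m))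
            (trans (toℕ-fromℕ< _)
              (trans (cong (λ z → lookup (point z (toℕ (coordinate {ns = rs} m i″))) m) (one≡ m)) (same m)))

  minor⇒contains : Minor K K (fibreFamily {D} {n} j ℓ M) →
    Contains {ms = zipWith _*_ (cube d K) rs} {ns = cube d n} M (_⊗_ {ms = cube d K} {ns = rs} P (R rs))
  minor⇒contains ((Θ , θ) , hits) = FromMinor.contains Θ θ hits

-- Counting the ones of a matrix that avoids the pattern

insertAt-replicate : ∀ {A : Set} n (i : Fin (suc n)) (x : A) → insertAt (replicate n x) i x ≡ replicate (suc n) x
insertAt-replicate n       zero    x = refl
insertAt-replicate (suc n) (suc i) x = cong (x ∷_) (insertAt-replicate n i x)

∑□-const : ∀ D N c → ∑□ (replicate D N) (λ _ → c) ≡ N ^ D * c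
∑□-const zero    N c = sym (+-identityʳ c)
∑□-const (suc D) N c = trans (∑<-cong N (λ _ → ∑□-const D N c)) (trans (∑<-const N (N ^ D * c)) (sym (*-assoc N (N ^ D) c)))

-- Slice the cube into lines parallel to axis `ℓ` and apply `count≤ν` to each; the second summand
-- collects the additive `j` of all `n ^ D` lines.
ones≤ : ∀ {D n N k j B} → n ≤ N → 1 ≤ j → (ℓ : Fin (suc D)) (M : Matrix (cube (suc D) n)) →
        Bounded k k D N N B → ¬ Minor k k (fibreFamily {D} {n} j ℓ M) →
        ones (cube (suc D) n) M ≤ j * B + n ^ D * j
ones≤ {D} {n} {N} {k} {j} {B} n≤N 1≤j ℓ M small ¬minor = begin
  ones (cube (suc D) n) M
    ≡⟨ ones≡∑□ (cube (suc D) n) M ⟩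
  ∑□ (cube (suc D) n) g
    ≡⟨ cong (λ Ns → ∑□ Ns g) (insertAt-replicate D ℓ n) ⟨
  ∑□ (insertAt (cube D n) ℓ n) g
    ≡⟨ ∑□-insertAt (cube D n) ℓ n g ⟩
  ∑< n (λ c → ∑□ (cube D n) (λ x → g (insertAt x ℓ c)))
    ≡⟨ ∑<-∑□-swap n (cube D n) _ ⟩
  ∑□ (cube D n) (λ x → count n (λ c → bit (cube (suc D) n) M (insertAt x ℓ c)))
    ≤⟨ ∑□-mono (cube D n) (λ x → count≤ν j 1≤j _ n) ⟩
  ∑□ (cube D n) (λ x → j * ν (E x) n + j)
    ≡⟨ trans (∑□-+ (cube D n) _ _) (cong₂ _+_ (∑□-*ˡ (cube D n) j _) (∑□-const D n j)) ⟩
  j * ∑□ (cube D n) (λ x → ν (E x) n) + n ^ D * j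
    ≤⟨ +-monoˡ-≤ (n ^ D * j) (*-monoʳ-≤ j (≤-trans
         (∑□-mono (cube D n) (λ x → ν-monoʳ (E x) n≤N))
         (≤-trans (∑□-monoˡ _ (cube≤ D)) (bound small E (λ x → within-monotone j _) ¬minor)))) ⟩
  j * B + n ^ D * j ∎
  where
  open ≤-Reasoning
  g : Vec ℕ (suc D) → ℕ
  g x = ⟦ bit (cube (suc D) n) M x ⟧
  E : Family D
  E = fibreFamily {D} {n} j ℓ M
  cube≤ : ∀ D → Pointwise _≤_ (cube D n) (cube D N)
  cube≤ zero    = []
  cube≤ (suc D) = n≤N ∷ cube≤ D

f≤ : ∀ {d} {ps : Vec ℕ d} {B} n (P : Matrix ps) →
     (∀ M → Avoids {ms = ps} {ns = cube d n} M P → ones (cube d n) M ≤ B) → f {ps = ps} n P ≤ B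
f≤ {d} {ps} {B} n P h = List.max≤v⁺ z≤n
  (ListAll.map⁺ (ListAll.map (λ {M} → h M) (ListAll.all-filter (avoids? ps (cube d n) P) (allMatrices (cube d n)))))

-- Rounding the side length up to a power of `t` costs at most a factor `t`. By induction on `n`,
-- the exponent has to change only when `t ^ e` equals the old value exactly.
next-power : ∀ t → 2 ≤ t → ∀ n → 1 ≤ n → ∃ λ e → n ≤ t ^ e × t ^ e ≤ t * n
next-power t 2≤t (suc zero)    _ = 0 , ≤-refl , ≤-trans (<⇒≤ 2≤t) (≤-reflexive (sym (*-identityʳ t)))
next-power t 2≤t (suc (suc n)) _ with next-power t 2≤t (suc n) (s≤s z≤n)
... | e , n≤ , ≤tn with suc (suc n) ≤? t ^ e
...   | yes h = e , h , ≤-trans ≤tn (*-monoʳ-≤ t (n≤1+n (suc n)))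
...   | no  h = suc e , lower , *-monoʳ-≤ t (≤-trans (≤-reflexive t^e≡) (n≤1+n (suc n)))
  where
  t^e≡ : t ^ e ≡ suc n
  t^e≡ = ≤-antisym (s≤s⁻¹ (≰⇒> h)) n≤
  lower : suc (suc n) ≤ t * t ^ e
  lower = begin
    suc (suc n)         ≤⟨ +-monoʳ-≤ 1 (m≤n+m (suc n) n) ⟩
    suc n + suc n       ≡⟨ cong (suc n +_) (+-identityʳ (suc n)) ⟨
    2 * suc n           ≤⟨ *-mono-≤ 2≤t (≤-reflexive (sym t^e≡)) ⟩
    t * t ^ e           ∎
    where open ≤-Reasoning

tupleShape : ∀ d → ℕ → ℕ → Fin d → Vec ℕ d
tupleShape d k j ℓ = zipWith _*_ (cube d k) (replicate d 1 [ ℓ ]≔ j)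

module FBound (D j : ℕ) (1≤j : 1 ≤ j) (α : ℕ)
  (small : ∀ k e → Bounded (suc k) (suc k) D (side k e) (side k e) ((2 ^ suc k) ^ α * (side k D) ^ e)) where

  private
    δ : ℕ
    -- Exponents of `T₀` for the factor `j`, for the constant of `items`, and for the factor `t ^ D`
    -- lost by rounding the side up to a power of `t`.
    δ = j + (α + (D + D))

  C : ℕ
  -- The two summands of `ones≤` are each at most `T₀ ^ δ * n ^ D`, and `2 ≤ T₀` absorbs the
  -- doubling.
  C = suc δ

  module _ (k n : ℕ) where
    open Constants k
    open ≤-Reasoning

    numeric : ∀ e → t ^ e ≤ t * n → j * (T₀ ^ α * (t ^ D) ^ e) + n ^ D * j ≤ 2 ^ (C * suc k) * n ^ D
    numeric e ≤tn = begin
      j * (T₀ ^ α * (t ^ D) ^ e) + n ^ D * j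
        ≤⟨ +-mono-≤ main (≤-trans (≤-reflexive (*-comm (n ^ D) j)) (*-monoˡ-≤ (n ^ D) (≤-trans (m≤T^m j) (^-monoʳ-≤ T₀ (m≤m+n j _))))) ⟩
      T₀ ^ δ * n ^ D + T₀ ^ δ * n ^ D
        ≡⟨ *-distribʳ-+ (n ^ D) (T₀ ^ δ) (T₀ ^ δ) ⟨
      (T₀ ^ δ + T₀ ^ δ) * n ^ D
        ≤⟨ *-monoˡ-≤ (n ^ D) (≤-trans (≤-reflexive (cong (T₀ ^ δ +_) (sym (+-identityʳ _)))) (*-monoˡ-≤ (T₀ ^ δ) 2≤T)) ⟩
      T₀ ^ C * n ^ D
        ≡⟨ cong (_* n ^ D) (trans (^-*-assoc 2 (suc k) C) (cong (2 ^_) (*-comm (suc k) C))) ⟩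
      2 ^ (C * suc k) * n ^ D ∎
      where
      power : (t ^ D) ^ e ≤ T₀ ^ (D + D) * n ^ D
      power = begin
        (t ^ D) ^ e          ≡⟨ trans (^-*-assoc t D e) (trans (cong (t ^_) (*-comm D e)) (sym (^-*-assoc t e D))) ⟩
        (t ^ e) ^ D          ≤⟨ ^-monoˡ-≤ D ≤tn ⟩
        (t * n) ^ D          ≡⟨ ^-distribʳ-* D t n ⟩
        t ^ D * n ^ D        ≡⟨ cong (_* n ^ D) (t^ D) ⟩
        T₀ ^ (D + D) * n ^ D ∎
      main : j * (T₀ ^ α * (t ^ D) ^ e) ≤ T₀ ^ δ * n ^ D
      main = begin
        j * (T₀ ^ α * (t ^ D) ^ e)
          ≤⟨ *-mono-≤ (m≤T^m j) (*-monoʳ-≤ (T₀ ^ α) power) ⟩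
        T₀ ^ j * (T₀ ^ α * (T₀ ^ (D + D) * n ^ D))
          ≡⟨ cong (T₀ ^ j *_) (*-assoc (T₀ ^ α) _ _) ⟨
        T₀ ^ j * (T₀ ^ α * T₀ ^ (D + D) * n ^ D)
          ≡⟨ *-assoc (T₀ ^ j) _ _ ⟨
        T₀ ^ j * (T₀ ^ α * T₀ ^ (D + D)) * n ^ D
          ≡⟨ cong (λ z → T₀ ^ j * z * n ^ D) (^-distribˡ-+-* T₀ α (D + D)) ⟨
        T₀ ^ j * T₀ ^ (α + (D + D)) * n ^ D
          ≡⟨ cong (_* n ^ D) (^-distribˡ-+-* T₀ j (α + (D + D))) ⟨
        T₀ ^ δ * n ^ D ∎

    power : 1 ≤ n → ∃ λ e → n ≤ t ^ e × t ^ e ≤ t * n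
    power = next-power t (≤-trans 2≤T (subst (T₀ ≤_) (sym t≡T²) (m≤m*n T₀ T₀))) n

  f≤C : ∀ k n (P : Matrix (cube (suc D) (suc k))) → IsPermutation (suc D) (suc k) P →
        (ℓ : Fin (suc D)) → 1 ≤ n →
        f {ps = tupleShape (suc D) (suc k) j ℓ} n
          (_⊗_ {ms = cube (suc D) (suc k)} {ns = replicate (suc D) 1 [ ℓ ]≔ j} P (R (replicate (suc D) 1 [ ℓ ]≔ j))) ≤
        2 ^ (C * suc k) * n ^ D
  f≤C k n P perm ℓ 1≤n = f≤ {ps = tupleShape (suc D) (suc k) j ℓ} n _ ones-bound
    where
    ones-bound : ∀ M → Avoids {ms = tupleShape (suc D) (suc k) j ℓ} {ns = cube (suc D) n} M
                   (_⊗_ {ms = cube (suc D) (suc k)} {ns = replicate (suc D) 1 [ ℓ ]≔ j} P (R (replicate (suc D) 1 [ ℓ ]≔ j))) →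
                 ones (cube (suc D) n) M ≤ 2 ^ (C * suc k) * n ^ D
    ones-bound M avoids = let e , n≤ , ≤tn = power k n 1≤n in ≤-trans
      (ones≤ {D} n≤ 1≤j ℓ M (small k e) (λ minor → avoids (minor⇒contains {D} j 1≤j ℓ P perm M minor)))
      (numeric k n e ≤tn)

-- Passage to the limit superior

open import Data.Integer as ℤ using (+_)
open import Data.Rational using (_/_)
import Data.Integer.Properties as ℤ

/-≤ : ∀ a b c .{{_ : NonZero b}} → a ≤ c * b → (+ a) ℚ./ b ℚ.≤ (+ c) ℚ./ 1
/-≤ a (suc b) c a≤cb = ℚ.toℚᵘ-cancel-≤ (begin
  ℚ.toℚᵘ ((+ a) ℚ./ suc b) ≃⟨ ℚ.toℚᵘ-fromℚᵘ (mkℚᵘ (+ a) b) ⟩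
  mkℚᵘ (+ a) b             ≤⟨ ℚᵘ.*≤* (subst₂ ℤ._≤_ (sym (ℤ.*-identityʳ (+ a))) (ℤ.pos-* c (suc b)) (ℤ.+≤+ a≤cb)) ⟩
  mkℚᵘ (+ c) 0             ≃⟨ ℚ.toℚᵘ-fromℚᵘ (mkℚᵘ (+ c) 0) ⟨
  ℚ.toℚᵘ ((+ c) ℚ./ 1)     ∎)
  where open ℚᵘ.≤-Reasoning

theorem4p1 : (d j : ℕ) → 1 ≤ d → 1 ≤ j →
    ∃ λ (C : ℕ) → 0 < C ×
    ((k : ℕ) → 1 ≤ k → (ps : Vec ℕ d) (P : Matrix ps) →
    IsTuplePermutation d k j {ps} P → S {d} {ps} P ≤ᵁ ((+ (2 ^ (C * k))) / 1))
theorem4p1 (suc D) j _ 1≤j =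
  C , s≤s z≤n , λ { (suc k) _ _ _ (generated P perm ℓ) q r<q →
    -- The bound holds for every side length, so it is itself an upper bound for the tail that
    -- starts at 0.
    (+ (2 ^ (C * suc k))) / 1 , 0 , r<q , λ n _ →
      /-≤ _ (suc n ^ D) (2 ^ (C * suc k)) {{m^n≢0 (suc n) D}} (f≤C k (suc n) P perm ℓ (s≤s z≤n)) }
  where open FBound D j 1≤j (proj₁ (items D)) (proj₂ (items D))
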